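{- Let $\mathcal{D}=\prod_{r=1}^d\mathcal{D}_r$ be a product distribution on $[n]^d$ and $\varepsilon\le 1/10$. For $r\in[d]$ and $j\in[n]$ let $\theta_r^j=\min\big(\sum_{k\le j}\mu_{\mathcal{D}_r}(k),\,1-\sum_{k\le j}\mu_{\mathcal{D}_r}(k)\big)$ and $\theta_r=\max_{1\le j\le n}\theta_r^j$. Any monotonicity tester on the hypergrid $[n]^d$ (functions $f:[n]^d\to\mathbb{N}$) with respect to $\mathcal{D}$ with proximity parameter $\varepsilon$ makes $\Omega\big(\sum_{r=1}^d\theta_r\big)$ queries.
   Context: $\mu_{\mathcal{D}_r}(k)$ is the probability of $k$ under $\mathcal{D}_r$. $f$ is monotone if $f(x)\le f(y)$ whenever $x\le y$ coordinatewise. A monotonicity tester w.r.t. $\mathcal{D}$ with proximity parameter $\varepsilon$ (possibly adaptive, two-sided error) accepts monotone $f$ with probability $>2/3$ and rejects with probability $>2/3$ every $f$ with $\min_{g\text{ monotone}}\Pr_{x\sim\mathcal{D}}[f(x)\ne g(x)]>\varepsilon$. -}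

module Defs where

open import Level using (Level; suc; _⊔_)
open import Algebra.Bundles using (CommutativeRing)
import Algebra.Construct.NaturalChoice.Min as NaturalMin
import Algebra.Properties.CommutativeMonoid.Sum as FiniteSum
import Algebra.Properties.Semiring.Mult as NaturalMultiple
open import Data.Bool using (Bool; true; false; if_then_else_)
import Data.Bool.Properties as Bool
open import Data.Fin using (Fin)
import Data.Fin as Fin
import Data.List as List
import Data.List.Extrema as Extrema
open import Data.Nat using (ℕ)
import Data.Nat as ℕ
open import Data.Product using (_×_)
open import Data.Vec using (Vec; []; _∷_; lookup)
open import Data.Vec.Relation.Binary.Pointwise.Inductive using (Pointwise)
open import Relation.Binary using (Rel; IsDecTotalOrder; DecTotalOrder)
import Relation.Binary.Construct.NonStrictToStrict as Strict
open import Relation.Binary.PropositionalEquality using (_≢_)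
open import Relation.Nullary using (¬_; Dec; does; ¬?)

-- Totally ordered fields, standing in for ℝ: these axioms hold for the
-- classical real numbers, and all probabilities below are elements of such a
-- field.  The inverse is total, with an unspecified value at zero.
record OrderedField (a ℓ₁ ℓ₂ : Level) : Set (suc (a ⊔ ℓ₁ ⊔ ℓ₂)) where
  field
    commutativeRing : CommutativeRing a ℓ₁

  open CommutativeRing commutativeRing public

  infix 4 _≤_
  infix 8 _⁻¹
  field
    _≤_             : Rel Carrier ℓ₂
    isDecTotalOrder : IsDecTotalOrder _≈_ _≤_
    +-monoʳ-≤       : ∀ x {y z} → y ≤ z → x + y ≤ x + z
    *-nonNegative   : ∀ {x y} → 0# ≤ x → 0# ≤ y → 0# ≤ x * y
    0≉1             : ¬ (0# ≈ 1#)
    _⁻¹             : Carrier → Carrier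
    *-inverseʳ      : ∀ x → ¬ (x ≈ 0#) → x * x ⁻¹ ≈ 1#

  decTotalOrder : DecTotalOrder a ℓ₁ ℓ₂
  decTotalOrder = record { isDecTotalOrder = isDecTotalOrder }

  open DecTotalOrder decTotalOrder public using (totalOrder)
  open Strict _≈_ _≤_ public using (_<_)
  open NaturalMin totalOrder public using (_⊓_)
  open Extrema totalOrder public using (max)
  open FiniteSum +-commutativeMonoid public using (sum)
  open FiniteSum *-commutativeMonoid public using () renaming (sum to product)
  open NaturalMultiple semiring using () renaming (_×_ to _·_)

  fromℕ : ℕ → Carrier
  fromℕ k = k · 1#

-- The hypergrid [n]^d; the values 1,…,n are represented as 0,…,n-1.
Point : ℕ → ℕ → Set
Point n d = Vec (Fin n) d

Monotone : ∀ {n d} → (Point n d → ℕ) → Set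
Monotone f = ∀ {x y} → Pointwise Fin._≤_ x y → f x ℕ.≤ f y

module Testing {a ℓ₁ ℓ₂} (𝔽 : OrderedField a ℓ₁ ℓ₂) where
  open OrderedField 𝔽

  record Distribution (n : ℕ) : Set (a ⊔ ℓ₁ ⊔ ℓ₂) where
    field
      μ           : Fin n → Carrier
      nonNegative : ∀ k → 0# ≤ μ k
      total       : sum μ ≈ 1#

  open Distribution public

  -- D r is the r-th factor of the product distribution.
  ProductDistribution : ℕ → ℕ → Set (a ⊔ ℓ₁ ⊔ ℓ₂)
  ProductDistribution n d = Fin d → Distribution n

  mass : ∀ {n d} → ProductDistribution n d → Point n d → Carrier
  mass D x = product (λ r → μ (D r) (lookup x r))

  sumPoints : ∀ {n} d → (Point n d → Carrier) → Carrier
  sumPoints ℕ.zero    w = w []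
  sumPoints (ℕ.suc d) w = sum (λ k → sumPoints d (λ x → w (k ∷ x)))

  Pr : ∀ {p n d} → ProductDistribution n d →
       {P : Point n d → Set p} → (∀ x → Dec (P x)) → Carrier
  Pr D P? = sumPoints _ (λ x → if does (P? x) then mass D x else 0#)

  dist : ∀ {n d} → ProductDistribution n d → (f g : Point n d → ℕ) → Carrier
  dist D f g = Pr D {λ x → f x ≢ g x} (λ x → ¬? (f x ℕ.≟ g x))

  -- A minimum over monotone g exceeds ε exactly when every monotone g does.
  FarFromMonotone : ∀ {n d} → ProductDistribution n d → Carrier →
                    (Point n d → ℕ) → Set (ℓ₁ ⊔ ℓ₂)
  FarFromMonotone D ε f = ∀ g → Monotone g → ε < dist D f g

  -- Randomized adaptive algorithms making at most q queries on every run.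
  -- Coins may be tossed between queries, with arbitrary weights depending on
  -- the history; the verdict true means "accept".  Since there are finitely
  -- many possible queries and verdicts at each step, a mixture of
  -- deterministic decision trees over any probability space has the same
  -- output behaviour as one of these trees (via conditional probabilities).
  data Algorithm (n d : ℕ) : ℕ → Set (a ⊔ ℓ₁ ⊔ ℓ₂) where
    output : ∀ {q} → Bool → Algorithm n d q
    toss   : ∀ {q m} → Distribution m → (Fin m → Algorithm n d q) →
             Algorithm n d q
    query  : ∀ {q} → Point n d → (ℕ → Algorithm n d q) →
             Algorithm n d (ℕ.suc q)

  outputProb : ∀ {n d q} → Algorithm n d q → (Point n d → ℕ) → Bool → Carrier
  outputProb (output b)  f v = if does (b Bool.≟ v) then 1# else 0#
  outputProb (toss E A)  f v = sum (λ i → μ E i * outputProb (A i) f v)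
  outputProb (query x A) f v = outputProb (A (f x)) f v

  IsMonotonicityTester : ∀ {n d q} → ProductDistribution n d → Carrier →
                         Algorithm n d q → Set (ℓ₁ ⊔ ℓ₂)
  IsMonotonicityTester D ε A =
    (∀ f → Monotone f → fromℕ 2 * fromℕ 3 ⁻¹ < outputProb A f true) ×
    (∀ f → FarFromMonotone D ε f →
       fromℕ 2 * fromℕ 3 ⁻¹ < outputProb A f false)

  cdf : ∀ {n} → Distribution n → Fin n → Carrier
  cdf E j = sum (λ k → if does (k Fin.≤? j) then μ E k else 0#)

  θ^ : ∀ {n} → Distribution n → Fin n → Carrier
  θ^ E j = cdf E j ⊓ (1# - cdf E j)

  -- The default value 0# of max does not affect the maximum: it is the value
  -- of θ^ at the last element of Fin n.
  θ : ∀ {n} → Distribution n → Carrier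
  θ E = max 0# (List.tabulate (θ^ E))

{-# OPTIONS --safe #-}
-- Coordinates are grouped into m = Ω(Σ θᵣ) blocks of total weight between 1/4
-- and 3/4, and a point x is reduced to m monotone bits, the j-th telling
-- whether some coordinate of the j-th block lies on the light side of its
-- threshold (all thresholds used have their light side in the same direction).
-- Read with the first bit most significant, these bits define a monotone
-- function; inverting the i-th digit makes it 1/10-far from monotone.
--
-- In the binary tree of bit vectors an independent uniform noise from
-- {0,…,12q} is added to the digit of every node.  At a node v of depth i, the
-- digit of the monotone function is noise + bit and that of the far function is
-- noise + (1 - bit), so as long as the queries passing through v all leave it
-- on the same side, the two differ by a shift of uniform noise and have
-- distance 1/(12q+1).  Hence telling them apart requires, with constant
-- probability, two queries branching at depth i; but each query branches off
-- from the earlier ones at one depth only, so that m = O(q).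
module Submission where

open import Defs
open import Data.Nat using (ℕ)
open import Data.Product using (∃-syntax; _×_)

import Algebra.Construct.NaturalChoice.Min as NaturalMin
import Algebra.Properties.Ring as RingProperties
import Algebra.Properties.Semiring.Mult as NaturalMultiple
import Algebra.Properties.Semiring.Sum as SemiringSum
import Algebra.Solver.Ring.NaturalCoefficients.Default as SemiringSolver
open import Data.Bool using (Bool; T; true; false; if_then_else_; not; _∧_; _∨_; _xor_)
import Data.Bool as Bool
import Data.Bool.Properties as Bool
open import Data.Fin using (Fin; zero; suc; toℕ; inject₁; combine; remQuot; funToFin; finToFun)
import Data.Fin as Fin
import Data.Fin.Properties as Fin
open import Data.List using (List; []; _∷_; map; tabulate)
import Data.List.Extrema as Extrema
open import Data.List.Extrema.Nat using (max; max≤v⁺; v≤max⁺)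
open import Data.List.Membership.Propositional using (_∈_)
import Data.List.Membership.Propositional.Properties as ∈
import Data.List.Relation.Unary.All as All
import Data.List.Relation.Unary.All.Properties as All
open import Data.List.Relation.Unary.Any using (here; there)
import Data.List.Relation.Unary.Any as Any
open import Data.Maybe using (Maybe; just; nothing)
open import Data.Nat using (zero; suc)
import Data.Nat as ℕ
import Data.Nat.Properties as ℕ
open import Data.Product using (_,_; proj₁; proj₂)
open import Data.Sum using (_⊎_; inj₁; inj₂)
open import Data.Vec using ([]; _∷_; lookup; _[_]≔_)
open import Data.Vec.Properties using (lookup∘update; lookup∘update′)
import Data.Vec.Functional as Vector
open import Data.Vec.Functional.Properties using (updateAt-updates; updateAt-minimal)
open import Data.Vec.Relation.Binary.Pointwise.Inductive as Pointwise using (Pointwise)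
open import Function using (_∘_; Equivalence)
import Level
open import Relation.Binary using (DecTotalOrder)
open import Relation.Binary.PropositionalEquality as ≡ using (_≡_; _≢_; _≗_)
import Relation.Binary.Reasoning.PartialOrder as PosetReasoning
import Relation.Binary.Reasoning.Setoid as SetoidReasoning
open import Relation.Nullary using (¬_; Dec; yes; no; does; contradiction; ¬?)
open import Relation.Nullary.Decidable using (dec-true; dec-false)

-- Values in ℕ are unbounded, so one answer may expose every digit of a point, and a tester need not
-- restrict itself to comparing answers. The noise takes the place of a reduction to
-- comparison-based testers. It can sit at the nodes without disturbing the order: two bit vectors
-- are compared at their first difference, and up to there both pass through the same nodes, hence
-- carry the same noise.
--
-- In the far function the nodes still follow the original bits, so for each depth i the two
-- functions differ in the i-th digit alone. Branchings are counted only in the run on the monotone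
-- function. This function is the same for every i, which is what allows the counts for all depths
-- to be added up and bounded by q.
--
-- The constants: both error probabilities are below 1/3 and the noise costs at most q/(12q+1), so
-- depth i is branched at with probability at least 1/3 - 1/12 = 1/4, whence m ≤ 4q.

module Field {a ℓ₁ ℓ₂} (𝔽 : OrderedField a ℓ₁ ℓ₂) where
  open OrderedField 𝔽 public hiding (zero)
  open DecTotalOrder decTotalOrder public using (poset)
    renaming (refl to ≤-refl; reflexive to ≤-reflexive; trans to ≤-trans; antisym to ≤-antisym; total to ≤-total)
  open SemiringSum semiring public
    using (sum-cong-≋; sum-replicate-zero; ∑-distrib-+; ∑-comm; *-distribˡ-sum; *-distribʳ-sum)
  open NaturalMultiple semiring using (×1-homo-*; ×-homo-+)
  open RingProperties ring using (-‿distribˡ-*; -‿involutive)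
  module Solver = SemiringSolver commutativeSemiring
  module ≤-Reasoning = PosetReasoning poset
  module ≈-Reasoning = SetoidReasoning setoid

  -- Arithmetic in an ordered field

  fromℕ-* : ∀ k l → fromℕ (k ℕ.* l) ≈ fromℕ k * fromℕ l
  fromℕ-* = ×1-homo-*

  fromℕ-+ : ∀ k l → fromℕ (k ℕ.+ l) ≈ fromℕ k + fromℕ l
  fromℕ-+ k l = ×-homo-+ 1# k l

  +-monoˡ-≤ : ∀ z {x y} → x ≤ y → x + z ≤ y + z
  +-monoˡ-≤ z {x} {y} x≤y = begin
    x + z ≈⟨ +-comm x z ⟩
    z + x ≤⟨ +-monoʳ-≤ z x≤y ⟩
    z + y ≈⟨ +-comm z y ⟩
    y + z ∎
    where open ≤-Reasoning

  +-mono-≤ : ∀ {x y u v} → x ≤ y → u ≤ v → x + u ≤ y + v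
  +-mono-≤ {y = y} {u} x≤y u≤v = ≤-trans (+-monoˡ-≤ u x≤y) (+-monoʳ-≤ y u≤v)

  +-nonNegative : ∀ {x y} → 0# ≤ x → 0# ≤ y → 0# ≤ x + y
  +-nonNegative 0≤x 0≤y = ≤-trans (≤-reflexive (sym (+-identityˡ 0#))) (+-mono-≤ 0≤x 0≤y)

  x≤x+y : ∀ x {y} → 0# ≤ y → x ≤ x + y
  x≤x+y x 0≤y = ≤-trans (≤-reflexive (sym (+-identityʳ x))) (+-monoʳ-≤ x 0≤y)

  x≤y+x : ∀ x {y} → 0# ≤ y → x ≤ y + x
  x≤y+x x 0≤y = ≤-trans (≤-reflexive (sym (+-identityˡ x))) (+-monoˡ-≤ x 0≤y)

  +-cancelʳ-≤ : ∀ z {x y} → x + z ≤ y + z → x ≤ y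
  +-cancelʳ-≤ z {x} {y} le = begin
    x             ≈⟨ drop x ⟨
    x + z + - z   ≤⟨ +-monoˡ-≤ (- z) le ⟩
    y + z + - z   ≈⟨ drop y ⟩
    y             ∎
    where
    open ≤-Reasoning
    drop : ∀ w → w + z + - z ≈ w
    drop w = trans (+-assoc w z (- z)) (trans (+-congˡ (-‿inverseʳ z)) (+-identityʳ w))

  difference : ∀ {x y} → x ≤ y → ∃[ t ] 0# ≤ t × y ≈ x + t
  difference {x} {y} x≤y = y + - x , nonneg , sym eq
    where
    nonneg : 0# ≤ y + - x
    nonneg = ≤-trans (≤-reflexive (sym (-‿inverseʳ x))) (+-monoˡ-≤ (- x) x≤y)
    eq : x + (y + - x) ≈ y
    eq = trans (+-comm x _) (trans (+-assoc y (- x) x) (trans (+-congˡ (-‿inverseˡ x)) (+-identityʳ y)))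

  *-monoˡ-≤ : ∀ {z x y} → 0# ≤ z → x ≤ y → z * x ≤ z * y
  *-monoˡ-≤ {z} {x} {y} 0≤z x≤y with t , 0≤t , y≈x+t ← difference x≤y = begin
    z * x         ≤⟨ x≤x+y (z * x) (*-nonNegative 0≤z 0≤t) ⟩
    z * x + z * t ≈⟨ distribˡ z x t ⟨
    z * (x + t)   ≈⟨ *-congˡ y≈x+t ⟨
    z * y         ∎
    where open ≤-Reasoning

  *-monoʳ-≤ : ∀ {z x y} → 0# ≤ z → x ≤ y → x * z ≤ y * z
  *-monoʳ-≤ {z} {x} {y} 0≤z x≤y =
    ≤-trans (≤-reflexive (*-comm x z)) (≤-trans (*-monoˡ-≤ 0≤z x≤y) (≤-reflexive (*-comm z y)))

  ¬≤⇒≥ : ∀ {x y} → ¬ (x ≤ y) → y ≤ x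
  ¬≤⇒≥ {x} {y} x≰y with ≤-total x y
  ... | inj₁ x≤y = contradiction x≤y x≰y
  ... | inj₂ y≤x = y≤x

  ¬≤⇒> : ∀ {x y} → ¬ (x ≤ y) → y < x
  ¬≤⇒> x≰y = ¬≤⇒≥ x≰y , λ y≈x → x≰y (≤-reflexive (sym y≈x))

  0≤1 : 0# ≤ 1#
  0≤1 with ≤-total 0# 1#
  ... | inj₁ le = le
  ... | inj₂ 1≤0 = begin
    0#              ≤⟨ *-nonNegative 0≤-1 0≤-1 ⟩
    - 1# * - 1#     ≈⟨ -‿distribˡ-* 1# (- 1#) ⟨
    - (1# * - 1#)   ≈⟨ -‿cong (*-identityˡ (- 1#)) ⟩
    - (- 1#)        ≈⟨ -‿involutive 1# ⟩
    1#              ∎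
    where
    open ≤-Reasoning
    0≤-1 : 0# ≤ - 1#
    0≤-1 = begin
      0#         ≈⟨ -‿inverseʳ 1# ⟨
      1# + - 1#  ≤⟨ +-monoˡ-≤ (- 1#) 1≤0 ⟩
      0# + - 1#  ≈⟨ +-identityˡ (- 1#) ⟩
      - 1#       ∎

  0≤fromℕ : ∀ k → 0# ≤ fromℕ k
  0≤fromℕ zero    = ≤-refl
  0≤fromℕ (suc k) = +-nonNegative 0≤1 (0≤fromℕ k)

  suc≰0 : ∀ k → ¬ (fromℕ (suc k) ≤ 0#)
  suc≰0 k le = 0≉1 (≤-antisym 0≤1 (≤-trans (x≤x+y 1# (0≤fromℕ k)) le))

  fromℕ-suc≉0 : ∀ k → ¬ (fromℕ (suc k) ≈ 0#)
  fromℕ-suc≉0 k eq = suc≰0 k (≤-reflexive eq)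

  suc-inverse : ∀ k → fromℕ (suc k) * fromℕ (suc k) ⁻¹ ≈ 1#
  suc-inverse k = *-inverseʳ _ (fromℕ-suc≉0 k)

  -- If x = y + t with t ≥ 0, then t ≤ (k + 1) t ≤ 0. No sign of an inverse enters; `0≤suc⁻¹` is
  -- derived from this.
  *-cancelˡ-≤ : ∀ k {x y} → fromℕ (suc k) * x ≤ fromℕ (suc k) * y → x ≤ y
  *-cancelˡ-≤ k {x} {y} le with ≤-total x y
  ... | inj₁ x≤y = x≤y
  ... | inj₂ y≤x with t , 0≤t , x≈y+t ← difference y≤x = ≤-reflexive (trans x≈y+t (trans (+-congˡ t≈0) (+-identityʳ y)))
    where
    open ≤-Reasoning
    s = fromℕ (suc k)
    t≤0 : t ≤ 0#
    t≤0 = begin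
      t              ≤⟨ x≤x+y t (*-nonNegative (0≤fromℕ k) 0≤t) ⟩
      t + fromℕ k * t ≈⟨ +-congʳ (*-identityˡ t) ⟨
      1# * t + fromℕ k * t ≈⟨ distribʳ t 1# (fromℕ k) ⟨
      s * t          ≤⟨ +-cancelʳ-≤ (s * y) lemma ⟩
      0#             ∎
      where
      lemma : s * t + s * y ≤ 0# + s * y
      lemma = begin
        s * t + s * y ≈⟨ +-comm _ _ ⟩
        s * y + s * t ≈⟨ distribˡ s y t ⟨
        s * (y + t)   ≈⟨ *-congˡ x≈y+t ⟨
        s * x         ≤⟨ le ⟩
        s * y         ≈⟨ +-identityˡ _ ⟨
        0# + s * y    ∎
    t≈0 : t ≈ 0#
    t≈0 = ≤-antisym t≤0 0≤t

  0≤suc⁻¹ : ∀ k → 0# ≤ fromℕ (suc k) ⁻¹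
  0≤suc⁻¹ k = *-cancelˡ-≤ k (≤-trans (≤-reflexive (zeroʳ _)) (≤-trans 0≤1 (≤-reflexive (sym (suc-inverse k)))))

  -- Indicators and finite sums

  𝟙 : Bool → Carrier
  𝟙 b = if b then 1# else 0#

  0≤𝟙 : ∀ b → 0# ≤ 𝟙 b
  0≤𝟙 true  = 0≤1
  0≤𝟙 false = ≤-refl

  𝟙≤1 : ∀ b → 𝟙 b ≤ 1#
  𝟙≤1 true  = ≤-refl
  𝟙≤1 false = 0≤1

  𝟙-not : ∀ b → 𝟙 (not b) + 𝟙 b ≈ 1#
  𝟙-not true  = +-identityˡ 1#
  𝟙-not false = +-identityʳ 1#

  sum-mono-≤ : ∀ {k} {f g : Fin k → Carrier} → (∀ i → f i ≤ g i) → sum f ≤ sum g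
  sum-mono-≤ {zero}  f≤g = ≤-refl
  sum-mono-≤ {suc k} f≤g = +-mono-≤ (f≤g zero) (sum-mono-≤ (λ i → f≤g (suc i)))

  sum-nonNegative : ∀ {k} {f : Fin k → Carrier} → (∀ i → 0# ≤ f i) → 0# ≤ sum f
  sum-nonNegative {zero}  0≤f = ≤-refl
  sum-nonNegative {suc k} 0≤f = +-nonNegative (0≤f zero) (sum-nonNegative (λ i → 0≤f (suc i)))

  sum-const : ∀ k x → sum {k} (λ _ → x) ≈ fromℕ k * x
  sum-const zero    x = sym (zeroˡ x)
  sum-const (suc k) x =
    trans (+-cong (sym (*-identityˡ x)) (sum-const k x)) (sym (distribʳ x 1# (fromℕ k)))

  𝟙≤∑ : ∀ {k} (b : Fin k → Bool) i → b i ≡ true → 1# ≤ sum (λ j → 𝟙 (b j))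
  𝟙≤∑ b zero    eq rewrite eq = x≤x+y 1# (sum-nonNegative (λ j → 0≤𝟙 (b (suc j))))
  𝟙≤∑ b (suc i) eq = ≤-trans (𝟙≤∑ (λ j → b (suc j)) i eq) (x≤y+x _ (0≤𝟙 (b zero)))

  ∑𝟙≤1 : ∀ {k} (b : Fin k → Bool) → (∀ {i j} → b i ≡ true → b j ≡ true → i ≡ j) → sum (λ j → 𝟙 (b j)) ≤ 1#
  ∑𝟙≤1 {zero}  b unique = 0≤1
  ∑𝟙≤1 {suc k} b unique with b zero in eq
  ... | false = ≤-trans (≤-reflexive (+-identityˡ _))
                  (∑𝟙≤1 (λ j → b (suc j)) (λ p q → Fin.suc-injective (unique p q)))
  ... | true  = ≤-reflexive (trans (+-congˡ (trans (sum-cong-≋ vanish) (sum-replicate-zero k))) (+-identityʳ 1#))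
    where
    vanish : ∀ j → 𝟙 (b (suc j)) ≈ 0#
    vanish j with b (suc j) in eq′
    ... | false = refl
    ... | true with () ← unique {zero} {suc j} eq eq′

-- Expectations under product distributions

module Expectation {a ℓ₁ ℓ₂} (𝔽 : OrderedField a ℓ₁ ℓ₂) where
  open Field 𝔽
  open Testing 𝔽

  mean : ∀ {m} → Distribution m → (Fin m → Carrier) → Carrier
  mean E F = sum (λ k → μ E k * F k)

  module _ {m} (E : Distribution m) where

    mean-cong : ∀ {F G} → (∀ k → F k ≈ G k) → mean E F ≈ mean E G
    mean-cong F≈G = sum-cong-≋ (λ k → *-congˡ (F≈G k))

    mean-mono : ∀ {F G} → (∀ k → F k ≤ G k) → mean E F ≤ mean E G
    mean-mono F≤G = sum-mono-≤ (λ k → *-monoˡ-≤ (nonNegative E k) (F≤G k))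

    mean-+ : ∀ F G → mean E (λ k → F k + G k) ≈ mean E F + mean E G
    mean-+ F G = trans (sum-cong-≋ (λ k → distribˡ (μ E k) (F k) (G k))) (∑-distrib-+ (λ k → μ E k * F k) (λ k → μ E k * G k))

    mean-const : ∀ x → mean E (λ _ → x) ≈ x
    mean-const x = trans (sym (*-distribʳ-sum x (μ E))) (trans (*-congʳ (total E)) (*-identityˡ x))

    mean-sum : ∀ {l} (F : Fin m → Fin l → Carrier) →
               mean E (λ k → sum (F k)) ≈ sum (λ i → mean E (λ k → F k i))
    mean-sum F = trans (sum-cong-≋ (λ k → *-distribˡ-sum (μ E k) (F k)))
                       (∑-comm (λ k i → μ E k * F k i))

    mean-* : ∀ x F → mean E (λ k → x * F k) ≈ x * mean E F
    mean-* x F = trans (sum-cong-≋ (λ k → swap (μ E k) (F k))) (sym (*-distribˡ-sum x (λ k → μ E k * F k)))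
      where
      swap : ∀ u v → u * (x * v) ≈ x * (u * v)
      swap u v = trans (sym (*-assoc u x v)) (trans (*-congʳ (*-comm u x)) (*-assoc x u v))

  -- An iterated mean rather than a sum weighted by `mass`, so that its laws follow by induction on
  -- the number of coordinates; `Pr≈𝔼` makes the connection with `Pr`.
  𝔼 : ∀ {n d} → ProductDistribution n d → (Point n d → Carrier) → Carrier
  𝔼 {d = zero}  D F = F []
  𝔼 {d = suc d} D F = mean (D zero) (λ k → 𝔼 (D ∘ suc) (λ x → F (k ∷ x)))

  𝔼-cong : ∀ {n d} (D : ProductDistribution n d) {F G} → (∀ x → F x ≈ G x) → 𝔼 D F ≈ 𝔼 D G
  𝔼-cong {d = zero}  D F≈G = F≈G []
  𝔼-cong {d = suc d} D F≈G = mean-cong (D zero) (λ k → 𝔼-cong (D ∘ suc) (λ x → F≈G (k ∷ x)))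

  𝔼-mono : ∀ {n d} (D : ProductDistribution n d) {F G} → (∀ x → F x ≤ G x) → 𝔼 D F ≤ 𝔼 D G
  𝔼-mono {d = zero}  D F≤G = F≤G []
  𝔼-mono {d = suc d} D F≤G = mean-mono (D zero) (λ k → 𝔼-mono (D ∘ suc) (λ x → F≤G (k ∷ x)))

  𝔼-+ : ∀ {n d} (D : ProductDistribution n d) F G → 𝔼 D (λ x → F x + G x) ≈ 𝔼 D F + 𝔼 D G
  𝔼-+ {d = zero}  D F G = refl
  𝔼-+ {d = suc d} D F G =
    trans (mean-cong (D zero) (λ k → 𝔼-+ (D ∘ suc) (λ x → F (k ∷ x)) (λ x → G (k ∷ x))))
          (mean-+ (D zero) _ _)

  𝔼-const : ∀ {n d} (D : ProductDistribution n d) x → 𝔼 D (λ _ → x) ≈ x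
  𝔼-const {d = zero}  D x = refl
  𝔼-const {d = suc d} D x =
    trans (mean-cong (D zero) (λ _ → 𝔼-const (D ∘ suc) x)) (mean-const (D zero) x)

  𝔼-* : ∀ {n d} (D : ProductDistribution n d) x F → 𝔼 D (λ y → x * F y) ≈ x * 𝔼 D F
  𝔼-* {d = zero}  D x F = refl
  𝔼-* {d = suc d} D x F =
    trans (mean-cong (D zero) (λ k → 𝔼-* (D ∘ suc) x (λ y → F (k ∷ y)))) (mean-* (D zero) x _)

  𝔼-sum : ∀ {n d l} (D : ProductDistribution n d) (F : Point n d → Fin l → Carrier) →
          𝔼 D (λ x → sum (F x)) ≈ sum (λ i → 𝔼 D (λ x → F x i))
  𝔼-sum {d = zero}  D F = refl
  𝔼-sum {d = suc d} D F =
    trans (mean-cong (D zero) (λ k → 𝔼-sum (D ∘ suc) (λ x → F (k ∷ x)))) (mean-sum (D zero) (λ k i → 𝔼 (D ∘ suc) (λ x → F (k ∷ x) i)))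

  𝔼-mean : ∀ {n d l} (D : ProductDistribution n d) (E : Distribution l) (F : Point n d → Fin l → Carrier) →
           𝔼 D (λ x → mean E (F x)) ≈ mean E (λ i → 𝔼 D (λ x → F x i))
  𝔼-mean D E F = trans (𝔼-sum D (λ x i → μ E i * F x i)) (sum-cong-≋ (λ i → 𝔼-* D (μ E i) (λ x → F x i)))

  𝔼-nonNegative : ∀ {n d} (D : ProductDistribution n d) {F} → (∀ x → 0# ≤ F x) → 0# ≤ 𝔼 D F
  𝔼-nonNegative D 0≤F = ≤-trans (≤-reflexive (sym (𝔼-const D 0#))) (𝔼-mono D 0≤F)

  -- Coordinates are independent, so redrawing one of them from its own factor preserves the joint
  -- law.
  𝔼-resample : ∀ {n d} (D : ProductDistribution n d) r F →
               𝔼 D F ≈ 𝔼 D (λ x → mean (D r) (λ k → F (x [ r ]≔ k)))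
  𝔼-resample D zero F = begin
    𝔼 D F
      ≈⟨ 𝔼-mean (D ∘ suc) (D zero) (λ x k → F (k ∷ x)) ⟨
    𝔼 (D ∘ suc) (λ x → mean (D zero) (λ k → F (k ∷ x)))
      ≈⟨ mean-const (D zero) _ ⟨
    𝔼 D (λ x → mean (D zero) (λ k → F (x [ zero ]≔ k)))   ∎
    where open ≈-Reasoning
  𝔼-resample D (suc r) F = mean-cong (D zero) (λ k → 𝔼-resample (D ∘ suc) r (λ x → F (k ∷ x)))

  mix : ∀ {n d} → (Fin d → Bool) → (x y : Point n d) → Point n d
  mix s []       []       = []
  mix s (k ∷ x) (l ∷ y) = (if s zero then l else k) ∷ mix (s ∘ suc) x y

  lookup-mix : ∀ {n d} (s : Fin d → Bool) (x y : Point n d) r →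
               lookup (mix s x y) r ≡ (if s r then lookup y r else lookup x r)
  lookup-mix s (k ∷ x) (l ∷ y) zero    = ≡.refl
  lookup-mix s (k ∷ x) (l ∷ y) (suc r) = lookup-mix (s ∘ suc) x y r

  -- Splicing two independent samples along a fixed set of coordinates gives one sample again. This
  -- serves to separate the noise at one depth from all the other noise.
  𝔼-mix : ∀ {n d} (D : ProductDistribution n d) s F →
          𝔼 D (λ x → 𝔼 D (λ y → F (mix s x y))) ≈ 𝔼 D F
  𝔼-mix {d = zero}  D s F = refl
  𝔼-mix {d = suc d} D s F = begin
    mean E (λ k → 𝔼 D′ (λ x → mean E (λ l → 𝔼 D′ (λ y → F (pick k l ∷ mix s′ x y)))))
      ≈⟨ mean-cong E (λ k → 𝔼-mean D′ E _) ⟩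
    mean E (λ k → mean E (λ l → 𝔼 D′ (λ x → 𝔼 D′ (λ y → F (pick k l ∷ mix s′ x y)))))
      ≈⟨ mean-cong E (λ k → mean-cong E (λ l → 𝔼-mix D′ s′ (λ z → F (pick k l ∷ z)))) ⟩
    mean E (λ k → mean E (λ l → 𝔼 D′ (λ z → F (pick k l ∷ z))))
      ≈⟨ choose (s zero) (λ k → 𝔼 D′ (λ z → F (k ∷ z))) ⟩
    mean E (λ k → 𝔼 D′ (λ z → F (k ∷ z))) ∎
    where
    open ≈-Reasoning
    E = D zero
    D′ = D ∘ suc
    s′ = s ∘ suc
    pick : _ → _ → _
    pick k l = if s zero then l else k
    choose : ∀ b G → mean E (λ k → mean E (λ l → G (if b then l else k))) ≈ mean E G
    choose true  G = mean-const E _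
    choose false G = mean-cong E (λ k → mean-const E (G k))

  private
    sumPoints-cong : ∀ {n} d {v w : Point n d → Carrier} → (∀ x → v x ≈ w x) → sumPoints d v ≈ sumPoints d w
    sumPoints-cong zero    v≈w = v≈w []
    sumPoints-cong (suc d) v≈w = sum-cong-≋ (λ k → sumPoints-cong d (λ x → v≈w (k ∷ x)))

    -- The factor `z` collects the masses of the coordinates already split off, which the induction
    -- needs.
    sumPoints-mass : ∀ {n d} (D : ProductDistribution n d) z F →
                     sumPoints d (λ x → z * mass D x * F x) ≈ z * 𝔼 D F
    sumPoints-mass {d = zero}  D z F = *-congʳ (*-identityʳ z)
    sumPoints-mass {d = suc d} D z F = begin
      sum (λ k → sumPoints d (λ x → z * (μ (D zero) k * mass (D ∘ suc) x) * F (k ∷ x)))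
        ≈⟨ sum-cong-≋ (λ k → sumPoints-cong d (λ x → *-congʳ (*-assoc z (μ (D zero) k) (mass (D ∘ suc) x)))) ⟨
      sum (λ k → sumPoints d (λ x → z * μ (D zero) k * mass (D ∘ suc) x * F (k ∷ x)))
        ≈⟨ sum-cong-≋ (λ k → sumPoints-mass (D ∘ suc) (z * μ (D zero) k) (λ x → F (k ∷ x))) ⟩
      sum (λ k → z * μ (D zero) k * 𝔼 (D ∘ suc) (λ x → F (k ∷ x)))
        ≈⟨ sum-cong-≋ (λ k → *-assoc z (μ (D zero) k) _) ⟩
      sum (λ k → z * (μ (D zero) k * 𝔼 (D ∘ suc) (λ x → F (k ∷ x))))
        ≈⟨ *-distribˡ-sum z (λ k → μ (D zero) k * 𝔼 (D ∘ suc) (λ x → F (k ∷ x))) ⟨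
      z * 𝔼 D F ∎
      where open ≈-Reasoning

  Pr≈𝔼 : ∀ {p n d} (D : ProductDistribution n d) {P : Point n d → Set p} (P? : ∀ x → Dec (P x)) →
         Pr D P? ≈ 𝔼 D (λ x → 𝟙 (does (P? x)))
  Pr≈𝔼 {d = d} D P? = begin
    sumPoints d (λ x → if does (P? x) then mass D x else 0#)
      ≈⟨ sumPoints-cong d (λ x → indicator (does (P? x)) (mass D x)) ⟩
    sumPoints d (λ x → 1# * mass D x * 𝟙 (does (P? x)))
      ≈⟨ sumPoints-mass D 1# _ ⟩
    1# * 𝔼 D (λ x → 𝟙 (does (P? x)))
      ≈⟨ *-identityˡ _ ⟩
    𝔼 D (λ x → 𝟙 (does (P? x))) ∎
    where
    open ≈-Reasoning
    indicator : ∀ b z → (if b then z else 0#) ≈ 1# * z * 𝟙 b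
    indicator true  z = sym (trans (*-identityʳ _) (*-identityˡ z))
    indicator false z = sym (zeroʳ _)

-- Bits under noise

bit : Bool → ℕ
bit b = if b then 1 else 0

-- The noise turning the bit b into the digit k + 1 (slot-bit): the digits
-- 1,…,L are exactly those that can arise from either bit.
slot : ∀ {L} → Bool → Fin L → Fin (suc L)
slot true  = inject₁
slot false = suc

slot-bit : ∀ {L} b (k : Fin L) → toℕ (slot b k) ℕ.+ bit b ≡ suc (toℕ k)
slot-bit true  k = ≡.trans (ℕ.+-comm _ 1) (≡.cong suc (Fin.toℕ-inject₁ k))
slot-bit false k = ℕ.+-identityʳ _

-- Runs of randomized decision trees

module Algorithms {a ℓ₁ ℓ₂} (𝔽 : OrderedField a ℓ₁ ℓ₂) where
  open Field 𝔽
  open Testing 𝔽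
  open Expectation 𝔽

  module _ {n d : ℕ} where

    outputProb-ext : ∀ {q} (A : Algorithm n d q) {f g} → f ≗ g → ∀ v → outputProb A f v ≈ outputProb A g v
    outputProb-ext (output b)  f≗g v = refl
    outputProb-ext (toss E A)  f≗g v = mean-cong E (λ i → outputProb-ext (A i) f≗g v)
    outputProb-ext (query x A) {f} f≗g v rewrite ≡.sym (f≗g x) = outputProb-ext (A (f x)) f≗g v

    0≤outputProb : ∀ {q} (A : Algorithm n d q) f v → 0# ≤ outputProb A f v
    0≤outputProb (output b)  f v = 0≤𝟙 _
    0≤outputProb (toss E A)  f v =
      ≤-trans (≤-reflexive (sym (mean-const E 0#))) (mean-mono E (λ i → 0≤outputProb (A i) f v))
    0≤outputProb (query x A) f v = 0≤outputProb (A (f x)) f v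

    outputProb-total : ∀ {q} (A : Algorithm n d q) f → outputProb A f true + outputProb A f false ≈ 1#
    outputProb-total (output true)  f = +-identityʳ 1#
    outputProb-total (output false) f = +-identityˡ 1#
    outputProb-total (toss E A)  f = begin
      mean E (λ i → outputProb (A i) f true) + mean E (λ i → outputProb (A i) f false) ≈⟨ mean-+ E _ _ ⟨
      mean E (λ i → outputProb (A i) f true + outputProb (A i) f false)
        ≈⟨ mean-cong E (λ i → outputProb-total (A i) f) ⟩
      mean E (λ _ → 1#) ≈⟨ mean-const E 1# ⟩
      1# ∎
      where open ≈-Reasoning
    outputProb-total (query x A) f = outputProb-total (A (f x)) f

    History : Set
    History = List (Point n d)

    -- The probability that some query x satisfies hit H x, where H lists the
    -- queries made before x.
    hitProb : (History → Point n d → Bool) → ∀ {q} → Algorithm n d q → (Point n d → ℕ) → History → Carrier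
    hitProb hit (output b)  f H = 0#
    hitProb hit (toss E A)  f H = mean E (λ i → hitProb hit (A i) f H)
    hitProb hit (query x A) f H = if hit H x then 1# else hitProb hit (A (f x)) f (x ∷ H)

    module _ (hit : History → Point n d → Bool) where

      hitProb-ext : ∀ {q} (A : Algorithm n d q) {f g} → f ≗ g → ∀ H → hitProb hit A f H ≈ hitProb hit A g H
      hitProb-ext (output b)  f≗g H = refl
      hitProb-ext (toss E A)  f≗g H = mean-cong E (λ i → hitProb-ext (A i) f≗g H)
      hitProb-ext (query x A) {f} f≗g H with hit H x
      ... | true  = refl
      ... | false rewrite ≡.sym (f≗g x) = hitProb-ext (A (f x)) f≗g (x ∷ H)

      0≤hitProb : ∀ {q} (A : Algorithm n d q) f H → 0# ≤ hitProb hit A f H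
      0≤hitProb (output b)  f H = ≤-refl
      0≤hitProb (toss E A)  f H =
        ≤-trans (≤-reflexive (sym (mean-const E 0#))) (mean-mono E (λ i → 0≤hitProb (A i) f H))
      0≤hitProb (query x A) f H with hit H x
      ... | true  = 0≤1
      ... | false = 0≤hitProb (A (f x)) f (x ∷ H)

      hitProb≤1 : ∀ {q} (A : Algorithm n d q) f H → hitProb hit A f H ≤ 1#
      hitProb≤1 (output b)  f H = 0≤1
      hitProb≤1 (toss E A)  f H =
        ≤-trans (mean-mono E (λ i → hitProb≤1 (A i) f H)) (≤-reflexive (mean-const E 1#))
      hitProb≤1 (query x A) f H with hit H x
      ... | true  = ≤-refl
      ... | false = hitProb≤1 (A (f x)) f (x ∷ H)

      hitProb-query : ∀ {q} x (A : ℕ → Algorithm n d q) f H →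
                      hitProb hit (A (f x)) f (x ∷ H) ≤ hitProb hit (query x A) f H
      hitProb-query x A f H with hit H x
      ... | true  = hitProb≤1 (A (f x)) f (x ∷ H)
      ... | false = ≤-refl

    -- By `unique` a query hits for at most one `i`, so it adds at most 1 to the sum. A hit ends the
    -- count for its own `i` only; adding `p i` on top of the indicator covers both cases.
    ∑hitProb≤q : ∀ {m} (hit : Fin m → History → Point n d → Bool) →
                 (∀ {i j} H x → hit i H x ≡ true → hit j H x ≡ true → i ≡ j) →
                 ∀ {q} (A : Algorithm n d q) f H → sum (λ i → hitProb (hit i) A f H) ≤ fromℕ q
    ∑hitProb≤q {m} hit unique {q} (output b) f H = ≤-trans (≤-reflexive (sum-replicate-zero m)) (0≤fromℕ q)
    ∑hitProb≤q hit unique {q} (toss E A) f H = begin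
      sum (λ i → mean E (λ k → hitProb (hit i) (A k) f H)) ≈⟨ mean-sum E (λ k i → hitProb (hit i) (A k) f H) ⟨
      mean E (λ k → sum (λ i → hitProb (hit i) (A k) f H)) ≤⟨ mean-mono E (λ k → ∑hitProb≤q hit unique (A k) f H) ⟩
      mean E (λ _ → fromℕ q)                               ≈⟨ mean-const E _ ⟩
      fromℕ q                                              ∎
      where open ≤-Reasoning
    ∑hitProb≤q hit unique {suc q} (query x A) f H = begin
      sum (λ i → if hit i H x then 1# else p i)    ≤⟨ sum-mono-≤ (λ i → bound (hit i H x) (0≤hitProb (hit i) (A (f x)) f (x ∷ H))) ⟩
      sum (λ i → 𝟙 (hit i H x) + p i)              ≈⟨ ∑-distrib-+ (λ i → 𝟙 (hit i H x)) p ⟩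
      sum (λ i → 𝟙 (hit i H x)) + sum p            ≤⟨ +-mono-≤ (∑𝟙≤1 (λ i → hit i H x) (unique H x))
                                                        (∑hitProb≤q hit unique (A (f x)) f (x ∷ H)) ⟩
      1# + fromℕ q                                 ∎
      where
      open ≤-Reasoning
      p : _ → Carrier
      p i = hitProb (hit i) (A (f x)) f (x ∷ H)
      bound : ∀ b {z} → 0# ≤ z → (if b then 1# else z) ≤ 𝟙 b + z
      bound true  0≤z = x≤x+y 1# 0≤z
      bound false 0≤z = ≤-reflexive (sym (+-identityˡ _))

  -- Indistinguishability of the two orientations

  uniform : ∀ L → Distribution (suc L)
  uniform L = record
    { μ           = λ _ → fromℕ (suc L) ⁻¹
    ; nonNegative = λ _ → 0≤suc⁻¹ L
    ; total       = trans (sum-const (suc L) _) (suc-inverse L)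
    }

  -- `slot s` is injective and misses a single noise value, the last for `true` and the first for
  -- `false`, whose term is nonnegative.
  sum-slot-≤ : ∀ {L} s (f : Fin (suc L) → Carrier) → (∀ k → 0# ≤ f k) → sum (λ k → f (slot s k)) ≤ sum f
  sum-slot-≤ false f 0≤f = x≤y+x _ (0≤f zero)
  sum-slot-≤ {zero}  true f 0≤f = sum-nonNegative 0≤f
  sum-slot-≤ {suc L} true f 0≤f = +-monoʳ-≤ (f zero) (sum-slot-≤ true (λ k → f (suc k)) (λ k → 0≤f (suc k)))

  -- One noise ρ v is shared by all points x with key x = v.  The view of
  -- orientation false consists of the values V x (ρ (key x) + bit (side x)), the
  -- one of orientation true uses the opposite bit.  Both are compared with the
  -- process in which the digit belonging to a key is drawn, from 1,…,L only,
  -- when the key is first met; it is their common part until hit occurs.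
  module Hiding {n d K L : ℕ}
    (key : Point n d → Fin K) (side : Point n d → Bool) (V : Point n d → ℕ → ℕ)
    (hit : History → Point n d → Bool)
    (hit-opposite : ∀ H x {y} → y ∈ H → key y ≡ key x → side y ≢ side x →
                    (∀ {z} → z ∈ H → key z ≡ key x → side z ≢ side x) → hit H x ≡ true)
    where

    u : Carrier
    u = fromℕ (suc L) ⁻¹

    0≤u : 0# ≤ u
    0≤u = 0≤suc⁻¹ L

    U : ProductDistribution (suc L) K
    U _ = uniform L

    -- For each key already met: its digit less one, and the side of the point at which it was met.
    Revealed : Set
    Revealed = Fin K → Maybe (Fin L × Bool)

    -- Keys already met have the noise forced by their digit, the others ρ.
    override : Bool → Maybe (Fin L × Bool) → Fin (suc L) → Fin (suc L)
    override o nothing        k = k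
    override o (just (k , b)) _ = slot (o xor b) k

    view : Bool → Revealed → Point (suc L) K → Point n d → ℕ
    view o τ ρ x = V x (toℕ (override o (τ (key x)) (lookup ρ (key x))) ℕ.+ bit (o xor side x))

    view-revealed : ∀ o τ ρ {x k} → τ (key x) ≡ just (k , side x) → view o τ ρ x ≡ V x (suc (toℕ k))
    view-revealed o τ ρ {x} {k} eq rewrite eq = ≡.cong (V x) (slot-bit (o xor side x) k)

    reveal : Revealed → Fin K → Fin L → Bool → Revealed
    reveal τ v k b = Vector.updateAt τ v (λ _ → just (k , b))

    -- Links the lazily drawn process with the actual noise: by `slot-bit`, the noise
    -- `slot (o xor b) k` is the one for which points on side `b` show the digit k + 1.
    view-reveal : ∀ o τ {v} ρ k b → τ v ≡ nothing →
                  view o τ (ρ [ v ]≔ slot (o xor b) k) ≗ view o (reveal τ v k b) ρ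
    view-reveal o τ {v} ρ k b eq x with key x Fin.≟ v
    ... | yes ≡.refl rewrite eq | lookup∘update (key x) ρ (slot (o xor b) k)
                           | updateAt-updates (key x) {λ _ → just (k , b)} τ = ≡.refl
    ... | no ≢v rewrite lookup∘update′ ≢v ρ (slot (o xor b) k)
                      | updateAt-minimal (key x) v {λ _ → just (k , b)} τ ≢v = ≡.refl

    -- Together the fields provide the premises of `hit-opposite`: `revealed` yields an earlier
    -- query with the key, and `queried` puts all such queries on the recorded side.
    record Consistent (τ : Revealed) (H : History) : Set where
      field
        queried  : ∀ {y} → y ∈ H → ∃[ k ] τ (key y) ≡ just (k , side y)
        revealed : ∀ {v k b} → τ v ≡ just (k , b) → ∃[ y ] y ∈ H × key y ≡ v × side y ≡ b
    open Consistent

    consistent-old : ∀ {τ H x k} → Consistent τ H → τ (key x) ≡ just (k , side x) → Consistent τ (x ∷ H)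
    queried (consistent-old C eq) (here ≡.refl) = _ , eq
    queried (consistent-old C eq) (there y∈H) = queried C y∈H
    revealed (consistent-old C eq) eq′ with y , y∈H , p ← revealed C eq′ = y , there y∈H , p

    consistent-new : ∀ {τ H x} k → Consistent τ H → τ (key x) ≡ nothing →
                     Consistent (reveal τ (key x) k (side x)) (x ∷ H)
    queried (consistent-new {τ} {x = x} k C eq) (here ≡.refl) = k , updateAt-updates (key x) τ
    queried (consistent-new {τ} {x = x} k C eq) {y} (there y∈H)
      with l , eq′ ← queried C y∈H
      = l , ≡.trans (updateAt-minimal (key y) (key x) τ
                      (λ p → case≢ (≡.trans (≡.sym eq′) (≡.trans (≡.cong τ p) eq)))) eq′
      where
      case≢ : ∀ {z : Fin L × Bool} → just z ≢ nothing
      case≢ ()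
    revealed (consistent-new {τ} {x = x} k C eq) {v} eq′ with v Fin.≟ key x
    ... | yes ≡.refl with ≡.refl ← ≡.trans (≡.sym eq′) (updateAt-updates (key x) τ) =
      x , here ≡.refl , ≡.refl , ≡.refl
    ... | no v≢
      with y , y∈H , p ← revealed C (≡.trans (≡.sym (updateAt-minimal v (key x) τ v≢)) eq′) = y , there y∈H , p

    -- Redrawing the noise of `v` changes nothing on average, and leaving out the value missed by
    -- `slot s` can only lower the result.
    𝔼-slots : ∀ v s (G : Point (suc L) K → Carrier) → (∀ ρ → 0# ≤ G ρ) →
              sum (λ k → u * 𝔼 U (λ ρ → G (ρ [ v ]≔ slot s k))) ≤ 𝔼 U G
    𝔼-slots v s G 0≤G = begin
      sum (λ k → u * 𝔼 U (λ ρ → G (ρ [ v ]≔ slot s k)))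
        ≤⟨ sum-slot-≤ s (λ k → u * 𝔼 U (λ ρ → G (ρ [ v ]≔ k)))
             (λ k → *-nonNegative 0≤u (𝔼-nonNegative U (λ ρ → 0≤G _))) ⟩
      mean (uniform L) (λ k → 𝔼 U (λ ρ → G (ρ [ v ]≔ k)))
        ≈⟨ 𝔼-mean U (uniform L) (λ ρ k → G (ρ [ v ]≔ k)) ⟨
      𝔼 U (λ ρ → mean (uniform L) (λ k → G (ρ [ v ]≔ k)))
        ≈⟨ 𝔼-resample U v G ⟨
      𝔼 U G ∎
      where open ≤-Reasoning

    rejectOrHit : ∀ {q} → Algorithm n d q → (Point n d → ℕ) → History → Carrier
    rejectOrHit A f H = outputProb A f false + hitProb hit A f H

    -- With `f` the view of the monotone function and `g` that of the far one, this is the sum of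
    -- the two errors of a tester and of the chance to hit. A lower bound on its mean therefore
    -- forces a tester, whose errors are small, to hit often.
    failure : ∀ {q} → Algorithm n d q → (f g : Point n d → ℕ) → History → Carrier
    failure A f g H = rejectOrHit A f H + outputProb A g true

    rejectOrHit-ext : ∀ {q} (A : Algorithm n d q) {f g} → f ≗ g → ∀ H → rejectOrHit A f H ≈ rejectOrHit A g H
    rejectOrHit-ext A f≗g H = +-cong (outputProb-ext A f≗g false) (hitProb-ext hit A f≗g H)

    0≤rejectOrHit : ∀ {q} (A : Algorithm n d q) f H → 0# ≤ rejectOrHit A f H
    0≤rejectOrHit A f H = +-nonNegative (0≤outputProb A f false) (0≤hitProb hit A f H)

    failure-toss : ∀ {q l} (E : Distribution l) (A : Fin l → Algorithm n d q) f g H →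
                   mean E (λ i → failure (A i) f g H) ≈ failure (toss E A) f g H
    failure-toss E A f g H = trans (mean-+ E _ _) (+-congʳ (mean-+ E _ _))

    -- Of the L + 1 noise values of a fresh key, each of mass `u`, only L correspond to digits
    -- possible under both orientations. Giving up the remaining one costs `u` for this query, on
    -- top of `fromℕ q * u` for the later ones.
    step-bound : ∀ q (t : Fin L → Carrier) {R} → (∀ k → 1# ≤ t k + fromℕ q * u) →
                 sum (λ k → u * t k) ≤ R → 1# ≤ R + fromℕ (suc q) * u
    step-bound q t {R} 1≤t+qu ∑ut≤R = begin
      1#                                             ≈⟨ suc-inverse L ⟨
      fromℕ (suc L) * u                              ≈⟨ distribʳ u 1# (fromℕ L) ⟩
      1# * u + fromℕ L * u                           ≈⟨ +-congˡ (sum-const L u) ⟨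
      1# * u + sum {L} (λ _ → u)                     ≤⟨ +-monoʳ-≤ (1# * u) (sum-mono-≤ (λ k →
                                                          ≤-trans (≤-reflexive (sym (*-identityʳ u))) (*-monoˡ-≤ 0≤u (1≤t+qu k)))) ⟩
      1# * u + sum (λ k → u * (t k + qu))            ≈⟨ +-congˡ (sum-cong-≋ (λ k → distribˡ u (t k) qu)) ⟩
      1# * u + sum (λ k → u * t k + u * qu)          ≈⟨ +-congˡ (∑-distrib-+ (λ k → u * t k) (λ _ → u * qu)) ⟩
      1# * u + (sum (λ k → u * t k) + sum {L} (λ _ → u * qu))
        ≤⟨ +-monoʳ-≤ (1# * u) (+-mono-≤ ∑ut≤R ≤qu) ⟩
      1# * u + (R + qu)                              ≈⟨ rearrange (1# * u) R qu ⟩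
      R + (1# * u + qu)                              ≈⟨ +-congˡ (distribʳ u 1# (fromℕ q)) ⟨
      R + fromℕ (suc q) * u                          ∎
      where
      open ≤-Reasoning
      qu = fromℕ q * u
      rearrange : ∀ x y z → x + (y + z) ≈ y + (x + z)
      rearrange = solve 3 (λ x y z → x :+ (y :+ z) := y :+ (x :+ z)) refl
        where open Solver
      ≤qu : sum {L} (λ _ → u * qu) ≤ qu
      ≤qu = begin
        sum {L} (λ _ → u * qu)     ≈⟨ sum-const L (u * qu) ⟩
        fromℕ L * (u * qu)         ≤⟨ *-monoʳ-≤ (*-nonNegative 0≤u (*-nonNegative (0≤fromℕ q) 0≤u)) (x≤y+x (fromℕ L) 0≤1) ⟩
        fromℕ (suc L) * (u * qu)   ≈⟨ *-assoc (fromℕ (suc L)) u qu ⟨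
        fromℕ (suc L) * u * qu     ≈⟨ *-congʳ (suc-inverse L) ⟩
        1# * qu                    ≈⟨ *-identityˡ qu ⟩
        qu                         ∎

    -- Until a hit, the lazily drawn process answers alike under both orientations. Hence both runs
    -- reach the same verdict, and each verdict is counted once: a rejection in the first view or an
    -- acceptance in the second.
    1≤𝔼failure : ∀ {q} (A : Algorithm n d q) τ H → Consistent τ H →
                 1# ≤ 𝔼 U (λ ρ → failure A (view false τ ρ) (view true τ ρ) H) + fromℕ q * u
    1≤𝔼failure {q} (output b) τ H C = begin
      1#                                                     ≈⟨ 𝔼-const U 1# ⟨
      𝔼 U (λ _ → 1#)                                         ≤⟨ 𝔼-mono U (λ _ → ≤-reflexive (sym (verdict b))) ⟩
      𝔼 U (λ ρ → failure {q} (output b) (view false τ ρ) (view true τ ρ) H) ≤⟨ x≤x+y _ (*-nonNegative (0≤fromℕ q) 0≤u) ⟩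
      𝔼 U (λ ρ → failure {q} (output b) (view false τ ρ) (view true τ ρ) H) + fromℕ q * u ∎
      where
      open ≤-Reasoning
      verdict : ∀ b → failure {q} (output b) (λ _ → 0) (λ _ → 0) H ≈ 1#
      verdict true  = trans (+-congʳ (+-identityʳ 0#)) (+-identityˡ 1#)
      verdict false = trans (+-identityʳ _) (+-identityʳ 1#)
    1≤𝔼failure {q} (toss E A) τ H C = begin
      1#                                     ≈⟨ mean-const E 1# ⟨
      mean E (λ _ → 1#)                      ≤⟨ mean-mono E (λ i → 1≤𝔼failure (A i) τ H C) ⟩
      mean E (λ i → 𝔼 U (F i) + fromℕ q * u) ≈⟨ trans (mean-+ E _ _) (+-congˡ (mean-const E _)) ⟩
      mean E (λ i → 𝔼 U (F i)) + fromℕ q * u ≈⟨ +-congʳ (𝔼-mean U E (λ ρ i → F i ρ)) ⟨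
      𝔼 U (λ ρ → mean E (λ i → F i ρ)) + fromℕ q * u
        ≈⟨ +-congʳ (𝔼-cong U (λ ρ → failure-toss E A (view false τ ρ) (view true τ ρ) H)) ⟩
      𝔼 U (λ ρ → failure (toss E A) (view false τ ρ) (view true τ ρ) H) + fromℕ q * u ∎
      where
      open ≤-Reasoning
      F : _ → _ → Carrier
      F i ρ = failure (A i) (view false τ ρ) (view true τ ρ) H
    1≤𝔼failure {suc q} (query x A) τ H C = byRevealed (τ (key x)) ≡.refl
      where
      byRevealed : ∀ r → τ (key x) ≡ r →
        1# ≤ 𝔼 U (λ ρ → failure (query x A) (view false τ ρ) (view true τ ρ) H) + fromℕ (suc q) * u
      byRevealed (just (k , b)) eq with b Bool.≟ side x
      -- Same side as before: the digit is k + 1 under both orientations, so both runs continue with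
      -- the same answer.
      ...   | yes ≡.refl = begin
        1# ≤⟨ 1≤𝔼failure (A c) τ (x ∷ H) (consistent-old C eq) ⟩
        𝔼 U (λ ρ → failure (A c) (view false τ ρ) (view true τ ρ) (x ∷ H)) + fromℕ q * u
          ≤⟨ +-mono-≤ (𝔼-mono U (λ ρ → +-mono-≤ (reject ρ) (accept ρ))) (*-monoʳ-≤ 0≤u (x≤y+x (fromℕ q) 0≤1)) ⟩
        𝔼 U (λ ρ → failure (query x A) (view false τ ρ) (view true τ ρ) H) + fromℕ (suc q) * u ∎
        where
        open ≤-Reasoning
        c = V x (suc (toℕ k))
        reject : ∀ ρ → rejectOrHit (A c) (view false τ ρ) (x ∷ H) ≤ rejectOrHit (query x A) (view false τ ρ) H
        reject ρ rewrite ≡.sym (view-revealed false τ ρ eq) = +-monoʳ-≤ _ (hitProb-query hit x A (view false τ ρ) H)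
        accept : ∀ ρ → outputProb (A c) (view true τ ρ) true ≤ outputProb (query x A) (view true τ ρ) true
        accept ρ rewrite ≡.sym (view-revealed true τ ρ eq) = ≤-refl
      -- Opposite side: the query hits, and the hit alone makes `failure` at least 1.
      ...   | no b≢ = begin
        1#              ≈⟨ 𝔼-const U 1# ⟨
        𝔼 U (λ _ → 1#)  ≤⟨ 𝔼-mono U certain ⟩
        𝔼 U (λ ρ → failure (query x A) (view false τ ρ) (view true τ ρ) H)
          ≤⟨ x≤x+y _ (*-nonNegative (0≤fromℕ (suc q)) 0≤u) ⟩
        𝔼 U (λ ρ → failure (query x A) (view false τ ρ) (view true τ ρ) H) + fromℕ (suc q) * u ∎
        where
        open ≤-Reasoning
        opposite : ∀ {z} → z ∈ H → key z ≡ key x → side z ≢ side x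
        opposite z∈H key≡ side≡ with l , eq′ ← queried C z∈H
          with ≡.refl ← ≡.trans (≡.sym eq) (≡.trans (≡.cong τ (≡.sym key≡)) eq′) = b≢ side≡
        hits : hit H x ≡ true
        hits with y , y∈H , key≡ , side≡ ← revealed C eq =
          hit-opposite H x y∈H key≡ (λ p → b≢ (≡.trans (≡.sym side≡) p)) opposite
        certain : ∀ ρ → 1# ≤ failure (query x A) (view false τ ρ) (view true τ ρ) H
        certain ρ rewrite hits =
          ≤-trans (x≤y+x 1# (0≤outputProb (query x A) (view false τ ρ) false))
                  (x≤x+y _ (0≤outputProb (query x A) (view true τ ρ) true))
      -- Fresh key: the digit k + 1 arises from the noise `slot s k` in one orientation and
      -- `slot (not s) k` in the other, both of mass `u`. The two means are thus resampled
      -- separately, each over its own set of noise values.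
      byRevealed nothing eq = step-bound q t IH (begin
        sum (λ k → u * t k)
          ≤⟨ sum-mono-≤ (λ k → ≤-trans (*-monoˡ-≤ 0≤u (≤-trans (≤-reflexive (𝔼-+ U _ _)) (+-mono-≤ (𝔼-mono U (reject k)) (𝔼-mono U (accept k)))))
                                    (≤-reflexive (distribˡ u _ _))) ⟩
        sum (λ k → u * 𝔼 U (λ ρ → Y (ρ [ v ]≔ slot s k)) + u * 𝔼 U (λ ρ → Z (ρ [ v ]≔ slot (not s) k)))
          ≈⟨ ∑-distrib-+ (λ k → u * 𝔼 U (λ ρ → Y (ρ [ v ]≔ slot s k))) (λ k → u * 𝔼 U (λ ρ → Z (ρ [ v ]≔ slot (not s) k))) ⟩
        sum (λ k → u * 𝔼 U (λ ρ → Y (ρ [ v ]≔ slot s k))) + sum (λ k → u * 𝔼 U (λ ρ → Z (ρ [ v ]≔ slot (not s) k)))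
          ≤⟨ +-mono-≤ (𝔼-slots v s Y (λ ρ → 0≤rejectOrHit (query x A) (view false τ ρ) H))
                      (𝔼-slots v (not s) Z (λ ρ → 0≤outputProb (query x A) (view true τ ρ) true)) ⟩
        𝔼 U Y + 𝔼 U Z
          ≈⟨ 𝔼-+ U Y Z ⟨
        𝔼 U (λ ρ → failure (query x A) (view false τ ρ) (view true τ ρ) H) ∎)
        where
        open ≤-Reasoning
        v = key x
        s = side x
        Y Z : Point (suc L) K → Carrier
        Y ρ = rejectOrHit (query x A) (view false τ ρ) H
        Z ρ = outputProb (query x A) (view true τ ρ) true
        τ′ : Fin L → Revealed
        τ′ k = reveal τ v k s
        c : Fin L → ℕ
        c k = V x (suc (toℕ k))
        t : Fin L → Carrier
        t k = 𝔼 U (λ ρ → failure (A (c k)) (view false (τ′ k) ρ) (view true (τ′ k) ρ) (x ∷ H))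
        IH : ∀ k → 1# ≤ t k + fromℕ q * u
        IH k = 1≤𝔼failure (A (c k)) (τ′ k) (x ∷ H) (consistent-new k C eq)
        value : ∀ o k ρ → view o (τ′ k) ρ x ≡ c k
        value o k ρ = view-revealed o (τ′ k) ρ (updateAt-updates v τ)
        reject : ∀ k ρ → rejectOrHit (A (c k)) (view false (τ′ k) ρ) (x ∷ H) ≤ Y (ρ [ v ]≔ slot s k)
        reject k ρ = ≤-trans
          (≡.subst (λ z → rejectOrHit (A z) (view false (τ′ k) ρ) (x ∷ H) ≤ rejectOrHit (query x A) (view false (τ′ k) ρ) H)
            (value false k ρ) (+-monoʳ-≤ _ (hitProb-query hit x A (view false (τ′ k) ρ) H)))
          (≤-reflexive (sym (rejectOrHit-ext (query x A) (view-reveal false τ ρ k s eq) H)))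
        accept : ∀ k ρ → outputProb (A (c k)) (view true (τ′ k) ρ) true ≤ Z (ρ [ v ]≔ slot (not s) k)
        accept k ρ = ≤-trans
          (≡.subst (λ z → outputProb (A z) (view true (τ′ k) ρ) true ≤ outputProb (query x A) (view true (τ′ k) ρ) true)
            (value true k ρ) ≤-refl)
          (≤-reflexive (sym (outputProb-ext (query x A) (view-reveal true τ ρ k s eq) true)))

-- First differences and lexicographic order

Agree : ∀ {m} {A : Set} → Fin m → (y z : Fin m → A) → Set
Agree i y z = ∀ j → j Fin.< i → y j ≡ z j

firstDifference : ∀ {m} (y z : Fin m → Bool) → y ≗ z ⊎ (∃[ i ] Agree i y z × y i ≢ z i)
firstDifference {zero}  y z = inj₁ λ ()
firstDifference {suc m} y z with y zero Bool.≟ z zero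
... | no ≢₀ = inj₂ (zero , (λ _ ()) , ≢₀)
... | yes ≡₀ with firstDifference (y ∘ suc) (z ∘ suc)
...   | inj₁ y≗z = inj₁ λ { zero → ≡₀ ; (suc j) → y≗z j }
...   | inj₂ (i , agree , ≢ᵢ) =
  inj₂ (suc i , (λ { zero _ → ≡₀ ; (suc j) (ℕ.s≤s j<i) → agree j j<i }) , ≢ᵢ)

lcp : ∀ {m} → (y z : Fin m → Bool) → ℕ
lcp {zero}  y z = 0
lcp {suc m} y z = if does (y zero Bool.≟ z zero) then suc (lcp (y ∘ suc) (z ∘ suc)) else 0

lcp-difference : ∀ {m} (y z : Fin m → Bool) i → Agree i y z → y i ≢ z i → lcp y z ≡ toℕ i
lcp-difference y z zero agree ≢ᵢ with y zero Bool.≟ z zero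
... | yes ≡₀ = contradiction ≡₀ ≢ᵢ
... | no  _  = ≡.refl
lcp-difference y z (suc i) agree ≢ᵢ with y zero Bool.≟ z zero
... | yes _  = ≡.cong suc (lcp-difference (y ∘ suc) (z ∘ suc) i (λ j j<i → agree (suc j) (ℕ.s≤s j<i)) ≢ᵢ)
... | no ≢₀  = contradiction (agree zero ℕ.z<s) ≢₀

lcp-agree : ∀ {m} (y z : Fin m → Bool) j → toℕ j ℕ.< lcp y z → y j ≡ z j
lcp-agree {suc m} y z j lt with y zero Bool.≟ z zero
lcp-agree {suc m} y z zero    lt         | yes ≡₀ = ≡₀
lcp-agree {suc m} y z (suc j) (ℕ.s≤s lt) | yes ≡₀ = lcp-agree (y ∘ suc) (z ∘ suc) j lt

-- Base-(M + 1) numerals, most significant digit first.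
numeral : ∀ {m} → ℕ → (Fin m → ℕ) → ℕ
numeral {zero}  M c = 0
numeral {suc m} M c = c zero ℕ.* suc M ℕ.^ m ℕ.+ numeral M (c ∘ suc)

numeral-cong : ∀ {m} M {b c : Fin m → ℕ} → b ≗ c → numeral M b ≡ numeral M c
numeral-cong {zero}  M b≗c = ≡.refl
numeral-cong {suc m} M b≗c =
  ≡.cong₂ (λ d v → d ℕ.* suc M ℕ.^ m ℕ.+ v) (b≗c zero) (numeral-cong M (b≗c ∘ suc))

numeral-bound : ∀ {m} M {c : Fin m → ℕ} → (∀ j → c j ℕ.≤ M) → numeral M c ℕ.< suc M ℕ.^ m
numeral-bound {zero}  M c≤M = ℕ.z<s
numeral-bound {suc m} M {c} c≤M = begin-strict
  c zero ℕ.* p ℕ.+ numeral M (c ∘ suc)  <⟨ ℕ.+-monoʳ-< (c zero ℕ.* p) (numeral-bound M (c≤M ∘ suc)) ⟩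
  c zero ℕ.* p ℕ.+ p                    ≤⟨ ℕ.+-monoˡ-≤ p (ℕ.*-monoˡ-≤ p (c≤M zero)) ⟩
  M ℕ.* p ℕ.+ p                         ≡⟨ ℕ.+-comm (M ℕ.* p) p ⟩
  suc M ℕ.* p                           ∎
  where
  open ℕ.≤-Reasoning
  p = suc M ℕ.^ m

-- One unit of the digit `i` is worth more than everything the later digits of `b` can contribute.
numeral-lex : ∀ {m} M {b c : Fin m → ℕ} → (∀ j → b j ℕ.≤ M) → ∀ i → Agree i b c → b i ℕ.< c i →
              numeral M b ℕ.< numeral M c
numeral-lex {suc m} M {b} {c} b≤M zero agree b<c = begin-strict
  b zero ℕ.* p ℕ.+ numeral M (b ∘ suc)  <⟨ ℕ.+-monoʳ-< (b zero ℕ.* p) (numeral-bound M (b≤M ∘ suc)) ⟩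
  b zero ℕ.* p ℕ.+ p                    ≡⟨ ℕ.+-comm (b zero ℕ.* p) p ⟩
  suc (b zero) ℕ.* p                    ≤⟨ ℕ.*-monoˡ-≤ p b<c ⟩
  c zero ℕ.* p                          ≤⟨ ℕ.m≤m+n _ _ ⟩
  c zero ℕ.* p ℕ.+ numeral M (c ∘ suc)  ∎
  where
  open ℕ.≤-Reasoning
  p = suc M ℕ.^ m
numeral-lex {suc m} M {b} {c} b≤M (suc i) agree b<c rewrite agree zero ℕ.z<s =
  ℕ.+-monoʳ-< (c zero ℕ.* suc M ℕ.^ m)
    (numeral-lex M (b≤M ∘ suc) i (λ j j<i → agree (suc j) (ℕ.s≤s j<i)) b<c)

-- Nodes of the binary tree

funToFin-cong : ∀ {m k} {f g : Fin m → Fin k} → f ≗ g → funToFin f ≡ funToFin g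
funToFin-cong {zero}  f≗g = ≡.refl
funToFin-cong {suc m} f≗g = ≡.cong₂ combine (f≗g zero) (funToFin-cong (f≗g ∘ suc))

boolToFin : Bool → Fin 2
boolToFin b = if b then suc zero else zero

boolToFin-injective : ∀ b c → boolToFin b ≡ boolToFin c → b ≡ c
boolToFin-injective true  true  _ = ≡.refl
boolToFin-injective false false _ = ≡.refl

-- Padding with zeros gives prefixes of all lengths codes of one type; `node` stores the depth
-- beside the code, so padding cannot be mistaken for zero bits.
prefix : ∀ {m} → Fin m → (Fin m → Bool) → Fin m → Fin 2
prefix i y j = if does (j Fin.<? i) then boolToFin (y j) else zero

-- The node at depth i of the binary tree through which the leaf y is reached.
node : ∀ {m} → Fin m → (Fin m → Bool) → Fin (m ℕ.* 2 ℕ.^ m)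
node i y = combine i (funToFin (prefix i y))

depth : ∀ {m} → Fin (m ℕ.* 2 ℕ.^ m) → Fin m
depth {m} v = proj₁ (remQuot (2 ℕ.^ m) v)

depth-node : ∀ {m} (i : Fin m) y → depth (node i y) ≡ i
depth-node i y = ≡.cong proj₁ (Fin.remQuot-combine i (funToFin (prefix i y)))

node-cong : ∀ {m} (i : Fin m) {y z} → Agree i y z → node i y ≡ node i z
node-cong i {y} {z} agree = ≡.cong (combine i) (funToFin-cong prefix≗)
  where
  prefix≗ : prefix i y ≗ prefix i z
  prefix≗ j = byOrder (j Fin.<? i)
    where
    byOrder : Dec (j Fin.< i) → prefix i y j ≡ prefix i z j
    byOrder (yes j<i) rewrite agree j j<i = ≡.refl
    byOrder (no j≮i) rewrite dec-false (j Fin.<? i) j≮i = ≡.refl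

node-agree : ∀ {m} (i : Fin m) {y z} → node i y ≡ node i z → Agree i y z
node-agree i {y} {z} eq j j<i = boolToFin-injective (y j) (z j)
  (≡.trans (≡.sym (prefix-below y)) (≡.trans prefix≡ (prefix-below z)))
  where
  prefix-below : ∀ w → prefix i w j ≡ boolToFin (w j)
  prefix-below w rewrite dec-true (j Fin.<? i) j<i = ≡.refl
  prefix≡ : prefix i y j ≡ prefix i z j
  prefix≡ = ≡.trans (≡.sym (Fin.finToFun-funToFin (prefix i y) j))
    (≡.trans (≡.cong (λ v → finToFun v j) (Fin.combine-injectiveʳ i _ i _ eq))
             (Fin.finToFun-funToFin (prefix i z) j))

-- Branching of query paths

module Tree {X : Set} {m : ℕ} (y : X → Fin m → Bool) where

  -- The depth at which the path to x leaves the tree spanned by H.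
  branching : List X → X → ℕ
  branching H x = max 0 (map (λ z → lcp (y x) (y z)) H)

  -- The default 0 of `max` makes the first query branch at the root. A query whose bits all repeat
  -- those of an earlier one has `branching` equal to `m` and so branches at no depth.
  branchesAt : Fin m → List X → X → Bool
  branchesAt i H x = does (branching H x ℕ.≟ toℕ i)

  branchesAt-unique : ∀ {i j} H x → branchesAt i H x ≡ true → branchesAt j H x ≡ true → i ≡ j
  branchesAt-unique {i} {j} H x p q = Fin.toℕ-injective (≡.trans (≡.sym (at p)) (at q))
    where
    at : ∀ {k} → branchesAt k H x ≡ true → branching H x ≡ toℕ k
    at {k} p = ℕ.≡ᵇ⇒≡ (branching H x) (toℕ k) (≡.subst T (≡.sym p) _)

  -- The point `z` shares exactly i bits with `x`. Sharing more would mean the same node at depth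
  -- `i` and the same bit there, which `opposite` excludes for every earlier query.
  branchesAt-opposite : ∀ i H x {z} → z ∈ H → node i (y z) ≡ node i (y x) → y z i ≢ y x i →
                        (∀ {w} → w ∈ H → node i (y w) ≡ node i (y x) → y w i ≢ y x i) →
                        branchesAt i H x ≡ true
  branchesAt-opposite i H x {z} z∈H node≡ side≢ opposite =
    dec-true (branching H x ℕ.≟ toℕ i) (ℕ.≤-antisym upper lower)
    where
    lower : toℕ i ℕ.≤ branching H x
    lower = v≤max⁺ 0 _ (inj₂ (Any.map (ℕ.≤-reflexive ∘ ≡.trans (≡.sym (lcp-difference (y x) (y z) i
      (λ j j<i → ≡.sym (node-agree i node≡ j j<i)) (side≢ ∘ ≡.sym)))) (∈.∈-map⁺ _ z∈H)))
    lcp≤ : ∀ {w} → w ∈ H → lcp (y x) (y w) ℕ.≤ toℕ i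
    lcp≤ {w} w∈H = ℕ.≮⇒≥ λ lt →
      opposite w∈H (node-cong i λ j j<i → ≡.sym (lcp-agree (y x) (y w) j (ℕ.<-trans j<i lt)))
                   (≡.sym (lcp-agree (y x) (y w) i lt))
    upper : branching H x ℕ.≤ toℕ i
    upper = max≤v⁺ ℕ.z≤n (All.map⁺ (All.tabulate lcp≤))

-- The monotone function and its far variants

module Hidden {X : Set} {m L : ℕ} (y : X → Fin m → Bool) (ω : Fin (m ℕ.* 2 ℕ.^ m) → Fin (suc L)) where

  -- With o = true the i-th bit is inverted, but only in the i-th digit: the
  -- nodes carrying the noise are those of the original bit vector.
  twist : Bool → Fin m → Fin m → Bool
  twist o i j = o ∧ does (j Fin.≟ i)

  digit : Bool → Fin m → X → Fin m → ℕ
  digit o i x j = toℕ (ω (node j (y x))) ℕ.+ bit (twist o i j xor y x j)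

  hidden : Bool → Fin m → X → ℕ
  hidden o i x = numeral (suc L) (digit o i x)

  bit≤1 : ∀ b → bit b ℕ.≤ 1
  bit≤1 true  = ℕ.≤-refl
  bit≤1 false = ℕ.z≤n

  digit-bound : ∀ o i x j → digit o i x j ℕ.≤ suc L
  digit-bound o i x j = ℕ.≤-trans
    (ℕ.+-mono-≤ (ℕ.≤-pred (Fin.toℕ<n (ω (node j (y x))))) (bit≤1 (twist o i j xor y x j)))
    (ℕ.≤-reflexive (ℕ.+-comm L 1))

  digit-cong : ∀ o i {x z} j → Agree j (y x) (y z) → y x j ≡ y z j → digit o i x j ≡ digit o i z j
  digit-cong o i j agree ≡ⱼ = ≡.cong₂ (λ v b → toℕ (ω v) ℕ.+ bit (twist o i j xor b)) (node-cong j agree) ≡ⱼ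

  -- The node at depth `k` depends only on the bits before `k`. Both points therefore carry the same
  -- noise up to and including the digit `k`, where the bits decide.
  hidden-lex : ∀ o i {x z} k → Agree k (y x) (y z) →
               bit (twist o i k xor y x k) ℕ.< bit (twist o i k xor y z k) → hidden o i x ℕ.< hidden o i z
  hidden-lex o i {x} {z} k agree lt =
    numeral-lex (suc L) (digit-bound o i x) k
      (λ j j<k → digit-cong o i j (λ l l<j → agree l (ℕ.<-trans l<j j<k)) (agree j j<k))
      (≡.subst (λ v → toℕ (ω v) ℕ.+ bit (twist o i k xor y x k) ℕ.< digit o i z k)
        (≡.sym (node-cong k agree)) (ℕ.+-monoʳ-< (toℕ (ω (node k (y z)))) lt))

  hidden-monotone : ∀ i {x z} → (∀ j → y x j Bool.≤ y z j) → hidden false i x ℕ.≤ hidden false i z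
  hidden-monotone i {x} {z} y≤ with firstDifference (y x) (y z)
  ... | inj₁ y≗ = ℕ.≤-reflexive (numeral-cong (suc L) (λ j → digit-cong false i j (λ l _ → y≗ l) (y≗ j)))
  ... | inj₂ (k , agree , ≢ₖ) = ℕ.<⇒≤ (hidden-lex false i k agree (bit< (y≤ k) ≢ₖ))
    where
    bit< : ∀ {b c} → b Bool.≤ c → b ≢ c → bit b ℕ.< bit c
    bit< Bool.f≤t ≢ = ℕ.z<s
    bit< Bool.b≤b ≢ = contradiction ≡.refl ≢

  -- The points part at depth `i`, where the inverted bit is larger for `x`. Their later digits
  -- carry unrelated noise but are less significant.
  hidden-violation : ∀ i {x z} → (∀ j → j ≢ i → y x j ≡ y z j) → y x i ≡ false → y z i ≡ true →
                     hidden true i z ℕ.< hidden true i x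
  hidden-violation i {x} {z} agree x≡ z≡ =
    hidden-lex true i i (λ j j<i → ≡.sym (agree j (Fin.<⇒≢ j<i))) lt
    where
    lt : bit (twist true i i xor y z i) ℕ.< bit (twist true i i xor y x i)
    lt rewrite dec-true (i Fin.≟ i) ≡.refl | x≡ | z≡ = ℕ.z<s

-- Finite disjunctions

any : ∀ {d} → (Fin d → Bool) → Bool
any = Vector.foldr _∨_ false

any-true⁺ : ∀ {d} (b : Fin d → Bool) r → b r ≡ true → any b ≡ true
any-true⁺ b zero    eq rewrite eq = ≡.refl
any-true⁺ b (suc r) eq = ≡.trans (≡.cong (b zero ∨_) (any-true⁺ (b ∘ suc) r eq)) (Bool.∨-zeroʳ (b zero))

any-true⁻ : ∀ {d} (b : Fin d → Bool) → any b ≡ true → ∃[ r ] b r ≡ true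
any-true⁻ {suc d} b eq with b zero in eq₀
... | true  = zero , eq₀
... | false with r , p ← any-true⁻ (b ∘ suc) eq = suc r , p

any-false⁺ : ∀ {d} (b : Fin d → Bool) → (∀ r → b r ≡ false) → any b ≡ false
any-false⁺ {zero}  b none = ≡.refl
any-false⁺ {suc d} b none rewrite none zero = any-false⁺ (b ∘ suc) (none ∘ suc)

any-false⁻ : ∀ {d} (b : Fin d → Bool) r → any b ≡ false → b r ≡ false
any-false⁻ b r eq = Bool.¬-not λ p → case≢ (≡.trans (≡.sym (any-true⁺ b r p)) eq)
  where
  case≢ : true ≢ false
  case≢ ()

any-cong : ∀ {d} {b c : Fin d → Bool} → b ≗ c → any b ≡ any c
any-cong {zero}  b≗c = ≡.refl
any-cong {suc d} b≗c = ≡.cong₂ _∨_ (b≗c zero) (any-cong (b≗c ∘ suc))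

-- Distance from monotonicity

module Distance {a ℓ₁ ℓ₂} (𝔽 : OrderedField a ℓ₁ ℓ₂) where
  open Field 𝔽
  open Testing 𝔽
  open Expectation 𝔽

  module _ {n d} (D : ProductDistribution n d) (σ : Fin d → Fin n → Bool) where

    special : Point n d → Bool
    special x = any (λ r → σ r (lookup x r))

    -- The expected number of special coordinates.
    weight : Carrier
    weight = sum (λ r → mean (D r) (λ k → 𝟙 (σ r k)))

    elsewhere : Fin d → Point n d → Fin d → Bool
    elsewhere r x s = not (does (s Fin.≟ r)) ∧ σ s (lookup x s)

    onlyAt : Fin d → Point n d → Bool
    onlyAt r x = σ r (lookup x r) ∧ not (any (elsewhere r x))

    elsewhere-false : ∀ r x s → elsewhere r x s ≡ false → s ≢ r → σ s (lookup x s) ≡ false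
    elsewhere-false r x s eq s≢r rewrite dec-false (s Fin.≟ r) s≢r = eq

    elsewhere-update : ∀ r x k → elsewhere r (x [ r ]≔ k) ≗ elsewhere r x
    elsewhere-update r x k s with s Fin.≟ r
    ... | yes _  = ≡.refl
    ... | no s≢r = ≡.cong (σ s) (lookup∘update′ s≢r x k)

    onlyAt-update : ∀ r x k → special x ≡ false → onlyAt r (x [ r ]≔ k) ≡ σ r k
    onlyAt-update r x k none
      rewrite lookup∘update r x k
            | any-cong (elsewhere-update r x k)
            | any-false⁺ (elsewhere r x) (λ s → ≡.trans (≡.cong (not (does (s Fin.≟ r)) ∧_)
                (any-false⁻ (λ s → σ s (lookup x s)) s none)) (Bool.∧-zeroʳ _))
      = Bool.∧-identityʳ (σ r k)

    onlyAt-unique : ∀ x {r s} → onlyAt r x ≡ true → onlyAt s x ≡ true → r ≡ s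
    onlyAt-unique x {r} {s} p q with r Fin.≟ s
    ... | yes r≡s = r≡s
    ... | no r≢s with σ r (lookup x r) in eq | any (elsewhere s x) in none | σ s (lookup x s)
    ...   | true | false | true
      with () ← ≡.trans (≡.sym eq) (elsewhere-false s x r (any-false⁻ (elsewhere s x) r none) r≢s)

    ∑onlyAt≤special : ∀ x → sum (λ r → 𝟙 (onlyAt r x)) ≤ 𝟙 (special x)
    ∑onlyAt≤special x with special x in eq
    ... | true  = ∑𝟙≤1 (λ r → onlyAt r x) (onlyAt-unique x)
    ... | false = ≤-reflexive (trans (sum-cong-≋ vanish) (sum-replicate-zero d))
      where
      vanish : ∀ r → 𝟙 (onlyAt r x) ≈ 0#
      vanish r rewrite any-false⁻ (λ r → σ r (lookup x r)) r eq = refl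

    -- The union bound for `special`.
    weight-bound : 1# ≤ 𝔼 D (λ x → 𝟙 (not (special x))) + weight
    weight-bound = begin
      1#                                                    ≈⟨ 𝔼-const D 1# ⟨
      𝔼 D (λ _ → 1#)                                        ≤⟨ 𝔼-mono D pointwise ⟩
      𝔼 D (λ x → 𝟙 (not (special x)) + sum (λ r → 𝟙 (σ r (lookup x r))))
        ≈⟨ 𝔼-+ D _ _ ⟩
      𝔼 D (λ x → 𝟙 (not (special x))) + 𝔼 D (λ x → sum (λ r → 𝟙 (σ r (lookup x r))))
        ≈⟨ +-congˡ (trans (𝔼-sum D (λ x r → 𝟙 (σ r (lookup x r)))) (sum-cong-≋ marginal)) ⟩
      𝔼 D (λ x → 𝟙 (not (special x))) + weight ∎
      where
      open ≤-Reasoning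
      pointwise : ∀ x → 1# ≤ 𝟙 (not (special x)) + sum (λ r → 𝟙 (σ r (lookup x r)))
      pointwise x with special x in eq
      ... | false = x≤x+y 1# (sum-nonNegative (λ r → 0≤𝟙 (σ r (lookup x r))))
      ... | true with r , p ← any-true⁻ (λ r → σ r (lookup x r)) eq =
        ≤-trans (𝟙≤∑ (λ r → σ r (lookup x r)) r p) (≤-reflexive (sym (+-identityˡ _)))
      marginal : ∀ r → 𝔼 D (λ x → 𝟙 (σ r (lookup x r))) ≈ mean (D r) (λ k → 𝟙 (σ r k))
      marginal r = trans (𝔼-resample D r _)
        (trans (𝔼-cong D (λ x → mean-cong (D r) (λ k →
                  reflexive (≡.cong (𝟙 ∘ σ r) (lookup∘update r x k)))))
               (𝔼-const D _))

    module _ (bad : Point n d → Bool) (weight≤1 : weight ≤ 1#)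
      (violation : ∀ x r k → special x ≡ false → σ r k ≡ true →
                   1# ≤ 𝟙 (bad x) + 𝟙 (bad (x [ r ]≔ k))) where

      private
        ν β : Point n d → Carrier
        ν x = 𝟙 (not (special x))
        β x = 𝟙 (bad x)

        0≤νβ : ∀ x → 0# ≤ ν x * β x
        0≤νβ x = *-nonNegative (0≤𝟙 _) (0≤𝟙 (bad x))

        moved : Fin d → Point n d → Carrier
        moved r x = mean (D r) (λ k → 𝟙 (σ r k) * (ν x * β (x [ r ]≔ k)))

        split : ∀ x → ν x * β x + sum (λ r → 𝟙 (onlyAt r x) * β x) ≤ β x
        split x = begin
          ν x * β x + sum (λ r → 𝟙 (onlyAt r x) * β x)  ≈⟨ +-congˡ (*-distribʳ-sum (β x) (λ r → 𝟙 (onlyAt r x))) ⟨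
          ν x * β x + sum (λ r → 𝟙 (onlyAt r x)) * β x  ≈⟨ distribʳ (β x) (ν x) _ ⟨
          (ν x + sum (λ r → 𝟙 (onlyAt r x))) * β x      ≤⟨ *-monoʳ-≤ (0≤𝟙 (bad x)) (+-monoʳ-≤ (ν x) (∑onlyAt≤special x)) ⟩
          (ν x + 𝟙 (special x)) * β x                   ≈⟨ *-congʳ (𝟙-not (special x)) ⟩
          1# * β x                                      ≈⟨ *-identityˡ (β x) ⟩
          β x                                           ∎
          where open ≤-Reasoning

        -- Setting the coordinate `r` of a point without special coordinates to a special value
        -- gives a point special only at `r`. So each term of `moved r` is dominated by the one that
        -- redrawing this coordinate produces on the right.
        moved≤ : ∀ r → 𝔼 D (moved r) ≤ 𝔼 D (λ x → 𝟙 (onlyAt r x) * β x)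
        moved≤ r = ≤-trans (𝔼-mono D (λ x → mean-mono (D r) (pointwise x)))
                           (≤-reflexive (sym (𝔼-resample D r _)))
          where
          pointwise : ∀ x k → 𝟙 (σ r k) * (ν x * β (x [ r ]≔ k)) ≤ 𝟙 (onlyAt r (x [ r ]≔ k)) * β (x [ r ]≔ k)
          pointwise x k with special x in eq
          ... | false rewrite onlyAt-update r x k eq = ≤-reflexive (*-congˡ (*-identityˡ _))
          ... | true  = ≤-trans (≤-reflexive (trans (*-congˡ (zeroˡ _)) (zeroʳ _)))
                                (*-nonNegative (0≤𝟙 _) (0≤𝟙 (bad (x [ r ]≔ k))))

        pairs : ∀ r x → mean (D r) (λ k → 𝟙 (σ r k)) * ν x ≤
                mean (D r) (λ k → 𝟙 (σ r k)) * (ν x * β x) + moved r x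
        pairs r x = begin
          mean (D r) (λ k → 𝟙 (σ r k)) * ν x
            ≈⟨ scale (ν x) ⟩
          mean (D r) (λ k → 𝟙 (σ r k) * ν x)
            ≤⟨ mean-mono (D r) pointwise ⟩
          mean (D r) (λ k → 𝟙 (σ r k) * (ν x * β x) + 𝟙 (σ r k) * (ν x * β (x [ r ]≔ k)))
            ≈⟨ mean-+ (D r) _ _ ⟩
          mean (D r) (λ k → 𝟙 (σ r k) * (ν x * β x)) + moved r x
            ≈⟨ +-congʳ (scale (ν x * β x)) ⟨
          mean (D r) (λ k → 𝟙 (σ r k)) * (ν x * β x) + moved r x ∎
          where
          open ≤-Reasoning
          scale : ∀ z → mean (D r) (λ k → 𝟙 (σ r k)) * z ≈ mean (D r) (λ k → 𝟙 (σ r k) * z)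
          scale z = trans (*-comm _ z) (trans (sym (mean-* (D r) z _)) (mean-cong (D r) (λ k → *-comm z _)))
          pointwise : ∀ k → 𝟙 (σ r k) * ν x ≤ 𝟙 (σ r k) * (ν x * β x) + 𝟙 (σ r k) * (ν x * β (x [ r ]≔ k))
          pointwise k with special x in eq | σ r k in eq′
          ... | false | true  = begin
            1# * 1#                                 ≈⟨ *-identityˡ 1# ⟩
            1#                                      ≤⟨ violation x r k eq eq′ ⟩
            β x + β (x [ r ]≔ k)                    ≈⟨ +-cong (unit (β x)) (unit (β (x [ r ]≔ k))) ⟨
            1# * (1# * β x) + 1# * (1# * β (x [ r ]≔ k)) ∎
            where
            unit : ∀ z → 1# * (1# * z) ≈ z
            unit z = trans (*-identityˡ _) (*-identityˡ z)
          ... | false | false = ≤-trans (≤-reflexive (zeroˡ _)) (+-nonNegative (≤-reflexive (sym (zeroˡ _))) (≤-reflexive (sym (zeroˡ _))))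
          ... | true  | b     = ≤-trans (≤-reflexive (zeroʳ _)) (+-nonNegative
            (*-nonNegative (0≤𝟙 b) (≤-reflexive (sym (zeroˡ _)))) (*-nonNegative (0≤𝟙 b) (≤-reflexive (sym (zeroˡ _)))))

      -- Each point without special coordinates is joined, for every special
      -- value k of every coordinate r, to the point obtained by setting the
      -- r-th coordinate to k; giving this edge the weight μ(x) μᵣ(k) loads no
      -- endpoint beyond its own mass, and one endpoint of each edge is bad.
      bad-mass : weight ≤ 𝔼 D (λ x → 𝟙 (bad x)) + weight * weight
      bad-mass = begin
        weight
          ≈⟨ *-identityʳ weight ⟨
        weight * 1#
          ≤⟨ *-monoˡ-≤ 0≤weight weight-bound ⟩
        weight * (𝔼 D ν + weight)
          ≈⟨ distribˡ weight _ _ ⟩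
        weight * 𝔼 D ν + weight * weight
          ≤⟨ +-monoˡ-≤ (weight * weight) edges ⟩
        𝔼 D β + weight * weight ∎
        where
        open ≤-Reasoning
        p : Fin d → Carrier
        p r = mean (D r) (λ k → 𝟙 (σ r k))
        0≤weight : 0# ≤ weight
        0≤weight = sum-nonNegative (λ r → ≤-trans (≤-reflexive (sym (mean-const (D r) 0#))) (mean-mono (D r) (λ k → 0≤𝟙 (σ r k))))
        edges : weight * 𝔼 D ν ≤ 𝔼 D β
        edges = begin
          weight * 𝔼 D ν
            ≈⟨ *-distribʳ-sum (𝔼 D ν) p ⟩
          sum (λ r → p r * 𝔼 D ν)
            ≈⟨ sum-cong-≋ (λ r → 𝔼-* D (p r) ν) ⟨
          sum (λ r → 𝔼 D (λ x → p r * ν x))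
            ≤⟨ sum-mono-≤ (λ r → 𝔼-mono D (pairs r)) ⟩
          sum (λ r → 𝔼 D (λ x → p r * (ν x * β x) + moved r x))
            ≈⟨ sum-cong-≋ (λ r → trans (𝔼-+ D _ _) (+-congʳ (𝔼-* D (p r) _))) ⟩
          sum (λ r → p r * 𝔼 D (λ x → ν x * β x) + 𝔼 D (moved r))
            ≈⟨ ∑-distrib-+ (λ r → p r * 𝔼 D (λ x → ν x * β x)) (λ r → 𝔼 D (moved r)) ⟩
          sum (λ r → p r * 𝔼 D (λ x → ν x * β x)) + sum (λ r → 𝔼 D (moved r))
            ≈⟨ +-congʳ (*-distribʳ-sum (𝔼 D (λ x → ν x * β x)) p) ⟨
          weight * 𝔼 D (λ x → ν x * β x) + sum (λ r → 𝔼 D (moved r))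
            ≤⟨ +-mono-≤ (≤-trans (*-monoʳ-≤ (𝔼-nonNegative D 0≤νβ) weight≤1) (≤-reflexive (*-identityˡ _)))
                        (sum-mono-≤ moved≤) ⟩
          𝔼 D (λ x → ν x * β x) + sum (λ r → 𝔼 D (λ x → 𝟙 (onlyAt r x) * β x))
            ≈⟨ +-congˡ (𝔼-sum D (λ x r → 𝟙 (onlyAt r x) * β x)) ⟨
          𝔼 D (λ x → ν x * β x) + 𝔼 D (λ x → sum (λ r → 𝟙 (onlyAt r x) * β x))
            ≈⟨ 𝔼-+ D _ _ ⟨
          𝔼 D (λ x → ν x * β x + sum (λ r → 𝟙 (onlyAt r x) * β x))
            ≤⟨ 𝔼-mono D split ⟩
          𝔼 D β ∎

  -- Evaluates to fromℕ k definitionally, unlike con k.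
  num : ∀ {v} → ℕ → Solver.Polynomial v
  num zero    = Solver.con 0
  num (suc k) = Solver.con 1 Solver.:+ num k

  double : ∀ z → z + z ≈ fromℕ 2 * z
  double = Solver.solve 1 (λ z → z Solver.:+ z Solver.:= num 2 Solver.:* z) refl

  -- P - P² ≥ 3/16 for 1/4 ≤ P ≤ 3/4.
  16δ≥3 : ∀ {P δ} → 1# ≤ fromℕ 4 * P → fromℕ 4 * P ≤ fromℕ 3 → P ≤ δ + P * P → fromℕ 3 ≤ fromℕ 16 * δ
  16δ≥3 {P} {δ} 1≤a a≤3 P≤ with v , 0≤v , 3≈a+v ← difference a≤3 = +-cancelʳ-≤ (α * α) (begin
    fromℕ 3 + α * α            ≈⟨ +-congʳ 3≈a+v ⟩
    (α + v) + α * α            ≤⟨ +-monoˡ-≤ (α * α) (+-monoʳ-≤ α v≤αv) ⟩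
    (α + α * v) + α * α        ≈⟨ solve 2 (λ α v → (α :+ α :* v) :+ α :* α := α :+ (α :+ v) :* α) refl α v ⟩
    α + (α + v) * α            ≈⟨ +-congˡ (*-congʳ 3≈a+v) ⟨
    α + fromℕ 3 * α            ≈⟨ solve 1 (λ p → num 4 :* p :+ num 3 :* (num 4 :* p) := num 16 :* p) refl P ⟩
    fromℕ 16 * P               ≤⟨ *-monoˡ-≤ (0≤fromℕ 16) P≤ ⟩
    fromℕ 16 * (δ + P * P)     ≈⟨ solve 2 (λ d p → num 16 :* (d :+ p :* p) := num 16 :* d :+ (num 4 :* p) :* (num 4 :* p)) refl δ P ⟩
    fromℕ 16 * δ + α * α       ∎)
    where
    open ≤-Reasoning
    open Solver
    α = fromℕ 4 * P
    -- This is (α - 1)(3 - α) ≥ 0 with `v` for 3 - α, free of subtraction as the semiring solver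
    -- requires.
    v≤αv : v ≤ α * v
    v≤αv = ≤-trans (≤-reflexive (sym (*-identityˡ v))) (*-monoʳ-≤ 0≤v 1≤a)

  -- 3/16 > 1/10 because 30 > 16: from δ ≤ ε one would get 30 ≤ 16, that is 14 ≤ 0.
  tenth< : ∀ {δ ε} → ε ≤ fromℕ 10 ⁻¹ → fromℕ 3 ≤ fromℕ 16 * δ → ε < δ
  tenth< {δ} {ε} ε≤ 3≤16δ = ¬≤⇒> λ δ≤ε → suc≰0 13 (+-cancelʳ-≤ (fromℕ 16) (begin
    fromℕ 14 + fromℕ 16       ≈⟨ fromℕ-+ 14 16 ⟨
    fromℕ 30                  ≈⟨ fromℕ-* 10 3 ⟩
    fromℕ 10 * fromℕ 3        ≤⟨ *-monoˡ-≤ (0≤fromℕ 10) 3≤16δ ⟩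
    fromℕ 10 * (fromℕ 16 * δ) ≤⟨ *-monoˡ-≤ (0≤fromℕ 10) (*-monoˡ-≤ (0≤fromℕ 16) (≤-trans δ≤ε ε≤)) ⟩
    fromℕ 10 * (fromℕ 16 * fromℕ 10 ⁻¹)
      ≈⟨ solve 3 (λ a b c → a :* (b :* c) := b :* (a :* c)) refl (fromℕ 10) (fromℕ 16) (fromℕ 10 ⁻¹) ⟩
    fromℕ 16 * (fromℕ 10 * fromℕ 10 ⁻¹) ≈⟨ *-congˡ (suc-inverse 9) ⟩
    fromℕ 16 * 1#             ≈⟨ *-identityʳ _ ⟩
    fromℕ 16                  ≈⟨ +-identityˡ _ ⟨
    0# + fromℕ 16             ∎))
    where
    open ≤-Reasoning
    open Solver

-- From the depth of the tree to the number of queries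

module QueryComplexity {a ℓ₁ ℓ₂} (𝔽 : OrderedField a ℓ₁ ℓ₂) where
  open Field 𝔽
  open Testing 𝔽
  open Expectation 𝔽
  open Algorithms 𝔽
  open Distance 𝔽

  module _ {n d q m} (D : ProductDistribution n d) {ε} (A : Algorithm n d q)
    (tester : IsMonotonicityTester D ε A) (y : Point n d → Fin m → Bool)
    (y-monotone : ∀ {x z} → Pointwise Fin._≤_ x z → ∀ j → y x j Bool.≤ y z j)
    (far : ∀ i (ω : Fin (m ℕ.* 2 ℕ.^ m) → Fin (suc (12 ℕ.* q))) →
           FarFromMonotone D ε (Hidden.hidden y ω true i))
    where

    private
      L K : ℕ
      -- Chosen so that the total loss q/(L + 1) stays below 1/12, a quarter of the 1/3 left over by
      -- the two errors.
      L = 12 ℕ.* q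
      K = m ℕ.* 2 ℕ.^ m

      u : Carrier
      u = fromℕ (suc L) ⁻¹

      U : ProductDistribution (suc L) K
      U _ = uniform L

      function : Bool → Fin m → Point (suc L) K → Point n d → ℕ
      function o i ω = Hidden.hidden y (lookup ω) o i

      at : Fin m → Fin K → Bool
      at i v = does (depth v Fin.≟ i)

      -- The function value as depending on the i-th digit alone, with the noise at the other depths
      -- frozen to `ω`.
      V : Fin m → Point (suc L) K → Point n d → ℕ → ℕ
      V i ω x c = numeral (suc L)
        (λ j → if does (j Fin.≟ i) then c else toℕ (lookup ω (node j (y x))) ℕ.+ bit (y x j))

      hit : Fin m → History → Point n d → Bool
      hit = Tree.branchesAt y

      module Depth i ω = Hiding {L = L} (node i ∘ y) (λ x → y x i) (V i ω) (hit i) (Tree.branchesAt-opposite y i)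

      -- The i-th digit uses noise of nodes of depth `i` only and the other digits use none of it,
      -- so reading that digit from `ρ` and the others from `ω` amounts to splicing the two.
      view≗function : ∀ o i ω ρ → Depth.view i ω o (λ _ → nothing) ρ ≗ function o i (mix (at i) ω ρ)
      view≗function o i ω ρ x = numeral-cong (suc L) digit≡
        where
        digit≡ : ∀ j → (if does (j Fin.≟ i) then toℕ (lookup ρ (node i (y x))) ℕ.+ bit (o xor y x i)
                        else toℕ (lookup ω (node j (y x))) ℕ.+ bit (y x j))
                       ≡ toℕ (lookup (mix (at i) ω ρ) (node j (y x))) ℕ.+ bit ((o ∧ does (j Fin.≟ i)) xor y x j)
        digit≡ j rewrite lookup-mix (at i) ω ρ (node j (y x)) | depth-node j (y x) with j Fin.≟ i
        ... | yes ≡.refl rewrite Bool.∧-identityʳ o = ≡.refl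
        ... | no _       rewrite Bool.∧-zeroʳ o     = ≡.refl

      hits : Fin m → Point (suc L) K → Carrier
      hits i ω = hitProb (hit i) A (function false i ω) []

      three : Carrier
      three = fromℕ 3

      third : ∀ f v → fromℕ 2 * fromℕ 3 ⁻¹ < outputProb A f v → three * outputProb A f (not v) ≤ 1#
      third f v (2/3≤ , _) = +-cancelʳ-≤ (three * outputProb A f v) (begin
        three * outputProb A f (not v) + three * outputProb A f v  ≈⟨ distribˡ three _ _ ⟨
        three * (outputProb A f (not v) + outputProb A f v)        ≈⟨ *-congˡ (total-not v) ⟩
        three * 1#                                                 ≈⟨ solve 0 (num 3 :* con 1 := con 1 :+ num 2) refl ⟩
        1# + fromℕ 2                                               ≈⟨ +-congˡ two ⟨
        1# + three * (fromℕ 2 * fromℕ 3 ⁻¹)                        ≤⟨ +-monoʳ-≤ 1# (*-monoˡ-≤ (0≤fromℕ 3) 2/3≤) ⟩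
        1# + three * outputProb A f v                              ∎)
        where
        open ≤-Reasoning
        open Solver
        total-not : ∀ v → outputProb A f (not v) + outputProb A f v ≈ 1#
        total-not true  = trans (+-comm _ _) (outputProb-total A f)
        total-not false = outputProb-total A f
        two : three * (fromℕ 2 * fromℕ 3 ⁻¹) ≈ fromℕ 2
        two = trans (solve 3 (λ a b c → a :* (b :* c) := b :* (a :* c)) refl three (fromℕ 2) (fromℕ 3 ⁻¹))
                    (trans (*-congˡ (suc-inverse 2)) (*-identityʳ _))

      rejects-monotone : ∀ i ω → three * outputProb A (function false i ω) false ≤ 1#
      rejects-monotone i ω = third _ true (proj₁ tester _
        λ x≤z → Hidden.hidden-monotone y (lookup ω) i (y-monotone x≤z))

      accepts-far : ∀ i ω → three * outputProb A (function true i ω) true ≤ 1#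
      accepts-far i ω = third _ false (proj₂ tester _ (far i (lookup ω)))

      3failure≤ : ∀ i ω ρ →
        three * Depth.failure i ω A (Depth.view i ω false (λ _ → nothing) ρ) (Depth.view i ω true (λ _ → nothing) ρ) []
        ≤ fromℕ 2 + three * hits i (mix (at i) ω ρ)
      3failure≤ i ω ρ = begin
        three * Depth.failure i ω A (Depth.view i ω false (λ _ → nothing) ρ) (Depth.view i ω true (λ _ → nothing) ρ) []
          ≈⟨ *-congˡ (+-cong (Depth.rejectOrHit-ext i ω A (view≗function false i ω ρ) [])
                             (outputProb-ext A (view≗function true i ω ρ) true)) ⟩
        three * ((rej + h) + acc)
          ≈⟨ solve 4 (λ t r h a → t :* ((r :+ h) :+ a) := t :* r :+ t :* a :+ t :* h) refl three rej h acc ⟩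
        three * rej + three * acc + three * h
          ≤⟨ +-monoˡ-≤ (three * h) (+-mono-≤ (rejects-monotone i η) (accepts-far i η)) ⟩
        1# + 1# + three * h
          ≈⟨ +-congʳ (solve 0 (con 1 :+ con 1 := num 2) refl) ⟩
        fromℕ 2 + three * h ∎
        where
        open ≤-Reasoning
        open Solver
        η = mix (at i) ω ρ
        rej = outputProb A (function false i η) false
        acc = outputProb A (function true i η) true
        h = hits i η

      -- `failure` has mean at least 1 - q u, of which the two errors account for at most 2/3; hits
      -- must make up the rest. Everything is scaled by 3 to avoid fractions.
      hit-frequently : ∀ i → 1# ≤ three * 𝔼 U (hits i) + three * (fromℕ q * u)
      hit-frequently i = +-cancelʳ-≤ (fromℕ 2) (begin
        1# + fromℕ 2                                     ≈⟨ solve 0 (con 1 :+ num 2 := num 3 :* con 1) refl ⟩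
        three * 1#                                       ≤⟨ *-monoˡ-≤ (0≤fromℕ 3) averaged ⟩
        three * (𝔼 U (λ ω → 𝔼 U (F ω)) + fromℕ q * u)     ≈⟨ distribˡ three _ _ ⟩
        three * 𝔼 U (λ ω → 𝔼 U (F ω)) + 3qu              ≈⟨ +-congʳ (trans (𝔼-cong U (λ ω → 𝔼-* U three (F ω))) (𝔼-* U three _)) ⟨
        𝔼 U (λ ω → 𝔼 U (λ ρ → three * F ω ρ)) + 3qu      ≤⟨ +-monoˡ-≤ 3qu (𝔼-mono U (λ ω → 𝔼-mono U (3failure≤ i ω))) ⟩
        𝔼 U (λ ω → 𝔼 U (λ ρ → G (mix (at i) ω ρ))) + 3qu ≈⟨ +-congʳ (𝔼-mix U (at i) G) ⟩
        𝔼 U G + 3qu                                      ≈⟨ +-congʳ (trans (𝔼-+ U _ _) (+-cong (𝔼-const U _) (𝔼-* U three (hits i)))) ⟩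
        fromℕ 2 + three * 𝔼 U (hits i) + 3qu             ≈⟨ trans (+-assoc _ _ _) (+-comm _ _) ⟩
        three * 𝔼 U (hits i) + 3qu + fromℕ 2             ∎)
        where
        open ≤-Reasoning
        open Solver
        3qu = three * (fromℕ q * u)
        F : Point (suc L) K → Point (suc L) K → Carrier
        F ω ρ = Depth.failure i ω A (Depth.view i ω false (λ _ → nothing) ρ) (Depth.view i ω true (λ _ → nothing) ρ) []
        G : Point (suc L) K → Carrier
        G η = fromℕ 2 + three * hits i η
        averaged : 1# ≤ 𝔼 U (λ ω → 𝔼 U (F ω)) + fromℕ q * u
        averaged = begin
          1#                                          ≈⟨ 𝔼-const U 1# ⟨
          𝔼 U (λ _ → 1#)                              ≤⟨ 𝔼-mono U (λ ω → Depth.1≤𝔼failure i ω A (λ _ → nothing) [] (consistent ω)) ⟩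
          𝔼 U (λ ω → 𝔼 U (F ω) + fromℕ q * u)         ≈⟨ trans (𝔼-+ U _ _) (+-congˡ (𝔼-const U _)) ⟩
          𝔼 U (λ ω → 𝔼 U (F ω)) + fromℕ q * u         ∎
          where
          consistent : ∀ ω → Depth.Consistent i ω (λ _ → nothing) []
          consistent ω = record { queried = λ () ; revealed = λ () }

      ∑hits≤q : sum (λ i → 𝔼 U (hits i)) ≤ fromℕ q
      ∑hits≤q = begin
        sum (λ i → 𝔼 U (hits i))          ≈⟨ 𝔼-sum U (λ ω i → hits i ω) ⟨
        𝔼 U (λ ω → sum (λ i → hits i ω))  ≤⟨ 𝔼-mono U (λ ω → ∑hitProb≤q hit (Tree.branchesAt-unique y) A (base ω) []) ⟩
        𝔼 U (λ _ → fromℕ q)               ≈⟨ 𝔼-const U _ ⟩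
        fromℕ q                           ∎
        where
        open ≤-Reasoning
        -- With orientation `false`, `twist` vanishes by computation: this is `function false i ω`
        -- for every `i`, so all depths are counted in one run.
        base : Point (suc L) K → Point n d → ℕ
        base ω x = numeral (suc L) (λ j → toℕ (lookup ω (node j (y x))) ℕ.+ bit (y x j))

    -- Summing four times `hit-frequently` over all depths gives 4m ≤ 12 S + m (12 q u) with S ≤ q
    -- and 12 q u ≤ 1, and one m cancels.
    depth≤queries : three * fromℕ m ≤ fromℕ 12 * fromℕ q
    depth≤queries = +-cancelʳ-≤ (fromℕ m) (begin
      three * fromℕ m + fromℕ m
        ≈⟨ solve 1 (λ m → num 3 :* m :+ m := num 4 :* (m :* con 1)) refl (fromℕ m) ⟩
      fromℕ 4 * (fromℕ m * 1#)
        ≈⟨ *-congˡ (sum-const m 1#) ⟨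
      fromℕ 4 * sum {m} (λ _ → 1#)
        ≤⟨ *-monoˡ-≤ (0≤fromℕ 4) (sum-mono-≤ hit-frequently) ⟩
      fromℕ 4 * sum (λ i → three * 𝔼 U (hits i) + three * (fromℕ q * u))
        ≈⟨ *-congˡ (trans (∑-distrib-+ (λ i → three * 𝔼 U (hits i)) (λ _ → three * (fromℕ q * u)))
                          (+-cong (sym (*-distribˡ-sum three (λ i → 𝔼 U (hits i)))) (sum-const m _))) ⟩
      fromℕ 4 * (three * S + fromℕ m * (three * (fromℕ q * u)))
        ≈⟨ solve 4 (λ s m q u → num 4 :* (num 3 :* s :+ m :* (num 3 :* (q :* u)))
                             := num 12 :* s :+ m :* ((num 12 :* q) :* u)) refl S (fromℕ m) (fromℕ q) u ⟩
      fromℕ 12 * S + fromℕ m * (fromℕ 12 * fromℕ q * u)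
        ≤⟨ +-mono-≤ (*-monoˡ-≤ (0≤fromℕ 12) ∑hits≤q) (*-monoˡ-≤ (0≤fromℕ m) 12qu≤1) ⟩
      fromℕ 12 * fromℕ q + fromℕ m * 1#
        ≈⟨ +-congˡ (*-identityʳ _) ⟩
      fromℕ 12 * fromℕ q + fromℕ m ∎)
      where
      open ≤-Reasoning
      open Solver
      S = sum (λ i → 𝔼 U (hits i))
      12qu≤1 : fromℕ 12 * fromℕ q * u ≤ 1#
      12qu≤1 = begin
        fromℕ 12 * fromℕ q * u   ≈⟨ *-congʳ (fromℕ-* 12 q) ⟨
        fromℕ L * u              ≤⟨ *-monoʳ-≤ (0≤suc⁻¹ L) (x≤y+x (fromℕ L) 0≤1) ⟩
        fromℕ (suc L) * u        ≈⟨ suc-inverse L ⟩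
        1#                       ∎

-- Thresholds and the grouping of coordinates

module Blocks {a ℓ₁ ℓ₂} (𝔽 : OrderedField a ℓ₁ ℓ₂) where
  open Field 𝔽
  open Testing 𝔽
  open Expectation 𝔽
  open Distance 𝔽

  blockWeight : ∀ {d} → (Fin d → ℕ) → (Fin d → Carrier) → ℕ → Carrier
  blockWeight block w b = sum (λ r → 𝟙 (does (block r ℕ.≟ b)) * w r)

  -- Blocks 0,…,m-1 are complete, block m is still being filled.
  record Blocking {d} (w : Fin d → Carrier) : Set (ℓ₁ Level.⊔ ℓ₂) where
    field
      m        : ℕ
      block    : Fin d → ℕ
      block≤m  : ∀ r → block r ℕ.≤ m
      heavy    : ∀ {b} → b ℕ.< m → 1# ≤ fromℕ 4 * blockWeight block w b
      light    : ∀ {b} → b ℕ.< m → fromℕ 4 * blockWeight block w b ≤ fromℕ 3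
      partial  : fromℕ 4 * blockWeight block w m ≤ 1#
      covering : fromℕ 4 * sum w ≤ fromℕ 3 * fromℕ m + fromℕ 4 * blockWeight block w m

  -- A block is closed once its weight reaches 1/4. Before its last coordinate it weighed at most
  -- 1/4, and a coordinate adds at most 1/2, so it never exceeds 3/4.
  greedyBlocking : ∀ {d} (w : Fin d → Carrier) → (∀ r → 0# ≤ w r) → (∀ r → fromℕ 2 * w r ≤ 1#) → Blocking w
  greedyBlocking {zero} w 0≤w w≤½ = record
    { m = 0 ; block = λ () ; block≤m = λ () ; heavy = λ () ; light = λ ()
    ; partial  = ≤-trans (≤-reflexive (zeroʳ _)) 0≤1
    ; covering = x≤y+x _ (≤-reflexive (sym (zeroʳ _)))
    }
  greedyBlocking {suc d} w 0≤w w≤½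
    with record { m = m ; block = block ; block≤m = block≤m ; heavy = heavy ; light = light
                ; partial = partial ; covering = covering }
         ← greedyBlocking (w ∘ suc) (0≤w ∘ suc) (w≤½ ∘ suc)
    = byWeight (≤-total (fromℕ 4 * W′ m) 1#)
    where
    open Solver using (solve; _:+_; _:*_; _:=_; con)
    W W′ : ℕ → Carrier
    W = blockWeight block (w ∘ suc)
    W′ = blockWeight (m Vector.∷ block) w

    old : ∀ {b} → m ≢ b → W′ b ≈ W b
    old {b} m≢b rewrite dec-false (m ℕ.≟ b) m≢b = trans (+-congʳ (zeroˡ _)) (+-identityˡ _)

    current : W′ m ≈ w zero + W m
    current rewrite dec-true (m ℕ.≟ m) ≡.refl = +-congʳ (*-identityˡ _)

    heavy′ : ∀ {b} → b ℕ.< m → 1# ≤ fromℕ 4 * W′ b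
    heavy′ b<m = ≤-trans (heavy b<m) (≤-reflexive (*-congˡ (sym (old (ℕ.>⇒≢ b<m)))))

    light′ : ∀ {b} → b ℕ.< m → fromℕ 4 * W′ b ≤ fromℕ 3
    light′ b<m = ≤-trans (≤-reflexive (*-congˡ (old (ℕ.>⇒≢ b<m)))) (light b<m)

    4W′m≈ : fromℕ 4 * W′ m ≈ fromℕ 4 * w zero + fromℕ 4 * W m
    4W′m≈ = trans (*-congˡ current) (distribˡ _ _ _)

    covering′ : fromℕ 4 * sum w ≤ fromℕ 3 * fromℕ m + fromℕ 4 * W′ m
    covering′ = begin
      fromℕ 4 * (w zero + sum (w ∘ suc))                                   ≈⟨ distribˡ _ _ _ ⟩
      fromℕ 4 * w zero + fromℕ 4 * sum (w ∘ suc)                           ≤⟨ +-monoʳ-≤ _ covering ⟩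
      fromℕ 4 * w zero + (fromℕ 3 * fromℕ m + fromℕ 4 * W m)               ≈⟨ solve 3 (λ x y z → x :+ (y :+ z) := y :+ (x :+ z)) refl _ _ _ ⟩
      fromℕ 3 * fromℕ m + (fromℕ 4 * w zero + fromℕ 4 * W m)               ≈⟨ +-congˡ 4W′m≈ ⟨
      fromℕ 3 * fromℕ m + fromℕ 4 * W′ m                                   ∎
      where open ≤-Reasoning

    4W′m≤3 : fromℕ 4 * W′ m ≤ fromℕ 3
    4W′m≤3 = begin
      fromℕ 4 * W′ m                        ≈⟨ 4W′m≈ ⟩
      fromℕ 4 * w zero + fromℕ 4 * W m      ≈⟨ +-congʳ (solve 1 (λ x → num 4 :* x := num 2 :* (num 2 :* x)) refl _) ⟩
      fromℕ 2 * (fromℕ 2 * w zero) + fromℕ 4 * W m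
                                            ≤⟨ +-mono-≤ (*-monoˡ-≤ (0≤fromℕ 2) (w≤½ zero)) partial ⟩
      fromℕ 2 * 1# + 1#                     ≈⟨ solve 0 (num 2 :* con 1 :+ con 1 := num 3) refl ⟩
      fromℕ 3                               ∎
      where open ≤-Reasoning

    block′≤m : ∀ r → (m Vector.∷ block) r ℕ.≤ m
    block′≤m zero    = ℕ.≤-refl
    block′≤m (suc r) = block≤m r

    fresh : W′ (suc m) ≈ 0#
    fresh = trans (sum-cong-≋ (λ r → vanish r (ℕ.<⇒≢ (ℕ.s≤s (block′≤m r))))) (sum-replicate-zero (suc d))
      where
      vanish : ∀ r → (m Vector.∷ block) r ≢ suc m → 𝟙 (does ((m Vector.∷ block) r ℕ.≟ suc m)) * w r ≈ 0#
      vanish r ≢ rewrite dec-false ((m Vector.∷ block) r ℕ.≟ suc m) ≢ = zeroˡ _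

    byWeight : fromℕ 4 * W′ m ≤ 1# ⊎ 1# ≤ fromℕ 4 * W′ m → Blocking w
    byWeight (inj₁ 4W′m≤1) = record
      { m = m ; block = m Vector.∷ block ; block≤m = block′≤m
      ; heavy = heavy′ ; light = light′ ; partial = 4W′m≤1 ; covering = covering′ }
    byWeight (inj₂ 1≤4W′m) = record
      { m = suc m ; block = m Vector.∷ block ; block≤m = ℕ.m≤n⇒m≤1+n ∘ block′≤m
      ; heavy    = λ b<1+m → heavy″ (ℕ.m≤n⇒m<n∨m≡n (ℕ.s≤s⁻¹ b<1+m))
      ; light    = λ b<1+m → light″ (ℕ.m≤n⇒m<n∨m≡n (ℕ.s≤s⁻¹ b<1+m))
      ; partial  = ≤-trans (≤-reflexive (trans (*-congˡ fresh) (zeroʳ _))) 0≤1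
      ; covering = begin
          fromℕ 4 * sum w                             ≤⟨ covering′ ⟩
          fromℕ 3 * fromℕ m + fromℕ 4 * W′ m          ≤⟨ +-monoʳ-≤ _ 4W′m≤3 ⟩
          fromℕ 3 * fromℕ m + fromℕ 3                 ≈⟨ solve 1 (λ m → num 3 :* m :+ num 3 := num 3 :* (con 1 :+ m)) refl _ ⟩
          fromℕ 3 * fromℕ (suc m)                     ≤⟨ x≤x+y _ (≤-reflexive (sym (trans (*-congˡ fresh) (zeroʳ _)))) ⟩
          fromℕ 3 * fromℕ (suc m) + fromℕ 4 * W′ (suc m) ∎
      }
      where
      open ≤-Reasoning
      heavy″ : ∀ {b} → b ℕ.< m ⊎ b ≡ m → 1# ≤ fromℕ 4 * W′ b
      heavy″ (inj₁ b<m)    = heavy′ b<m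
      heavy″ (inj₂ ≡.refl) = 1≤4W′m
      light″ : ∀ {b} → b ℕ.< m ⊎ b ≡ m → fromℕ 4 * W′ b ≤ fromℕ 3
      light″ (inj₁ b<m)    = light′ b<m
      light″ (inj₂ ≡.refl) = 4W′m≤3

  -- `σ` is an up-set for `o = false` and a down-set for `o = true`; `xor` with `o` makes both
  -- increasing.
  Directed : ∀ {n} → Bool → (Fin n → Bool) → Set
  Directed o σ = ∀ {k l} → k Fin.≤ l → (o xor σ k) Bool.≤ (o xor σ l)

  -- One side of the threshold attaining the maximum defining θ.
  record LightSide {n} (E : Distribution n) : Set (ℓ₁ Level.⊔ ℓ₂) where
    field
      orientation : Bool
      side        : Fin n → Bool
      directed    : Directed orientation side
      mean≈θ      : mean E (𝟙 ∘ side) ≈ θ E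
      2θ≤1        : fromℕ 2 * θ E ≤ 1#

  -- The maximum is either the default 0, for which the empty side serves, or attained at some `j`;
  -- there the minimum selects the initial segment up to `j` or its complement. The two have total
  -- mass 1, so the lighter has at most 1/2.
  lightSide : ∀ {n} (E : Distribution n) → LightSide E
  lightSide {n} E = byMaximum (Extrema.argmax-sel totalOrder (λ x → x) 0# (tabulate (θ^ E)))
    where
    open NaturalMin totalOrder using (⊓-sel; x⊓y≤x; x⊓y≤y)
    below : Fin n → Fin n → Bool
    below j k = does (k Fin.≤? j)

    cdf≈ : ∀ j → cdf E j ≈ mean E (𝟙 ∘ below j)
    cdf≈ j = sum-cong-≋ (λ k → indicator (below j k) (μ E k))
      where
      indicator : ∀ b z → (if b then z else 0#) ≈ z * 𝟙 b
      indicator true  z = sym (*-identityʳ z)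
      indicator false z = sym (zeroʳ z)

    sum-to-1 : ∀ j → cdf E j + (1# - cdf E j) ≈ 1#
    sum-to-1 j = trans (+-comm _ _) (trans (+-assoc _ _ _) (trans (+-congˡ (-‿inverseˡ _)) (+-identityʳ 1#)))

    above≈ : ∀ j → 1# - cdf E j ≈ mean E (𝟙 ∘ not ∘ below j)
    above≈ j = begin
      1# - cdf E j                                            ≈⟨ +-congʳ (mean-const E 1#) ⟨
      mean E (λ _ → 1#) - cdf E j                             ≈⟨ +-congʳ (mean-cong E (λ k → 𝟙-not (below j k))) ⟨
      mean E (λ k → 𝟙 (not (below j k)) + 𝟙 (below j k)) - cdf E j ≈⟨ +-congʳ (mean-+ E _ _) ⟩
      mean E (𝟙 ∘ not ∘ below j) + mean E (𝟙 ∘ below j) - cdf E j  ≈⟨ +-congʳ (+-congˡ (cdf≈ j)) ⟨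
      mean E (𝟙 ∘ not ∘ below j) + cdf E j - cdf E j          ≈⟨ +-assoc _ _ _ ⟩
      mean E (𝟙 ∘ not ∘ below j) + (cdf E j - cdf E j)        ≈⟨ +-congˡ (-‿inverseʳ _) ⟩
      mean E (𝟙 ∘ not ∘ below j) + 0#                         ≈⟨ +-identityʳ _ ⟩
      mean E (𝟙 ∘ not ∘ below j)                              ∎
      where open ≈-Reasoning

    not-antitone : ∀ b c → (T b → T c) → not c Bool.≤ not b
    not-antitone true  true  _   = Bool.b≤b
    not-antitone true  false b⇒c with () ← b⇒c _
    not-antitone false true  _   = Bool.f≤t
    not-antitone false false _   = Bool.b≤b

    above-directed : ∀ j → ∀ {k l} → k Fin.≤ l → not (below j k) Bool.≤ not (below j l)
    above-directed j {k} {l} k≤l =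
      not-antitone (below j l) (below j k) (ℕ.≤⇒≤ᵇ ∘ ℕ.≤-trans k≤l ∘ ℕ.≤ᵇ⇒≤ (toℕ l) (toℕ j))

    2θ^≤1 : ∀ j → fromℕ 2 * θ^ E j ≤ 1#
    2θ^≤1 j = begin
      fromℕ 2 * θ^ E j           ≈⟨ double _ ⟨
      θ^ E j + θ^ E j            ≤⟨ +-mono-≤ (x⊓y≤x _ _) (x⊓y≤y _ _) ⟩
      cdf E j + (1# - cdf E j)   ≈⟨ sum-to-1 j ⟩
      1#                         ∎
      where open ≤-Reasoning

    byMaximum : θ E ≡ 0# ⊎ _ → LightSide E
    byMaximum (inj₁ θ≡0) = record
      { orientation = false ; side = λ _ → false ; directed = λ _ → Bool.b≤b
      ; mean≈θ = trans (mean-const E 0#) (reflexive (≡.sym θ≡0))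
      ; 2θ≤1   = ≤-trans (≤-reflexive (trans (*-congˡ (reflexive θ≡0)) (zeroʳ _))) 0≤1
      }
    byMaximum (inj₂ θ∈) with j , θ≡ ← ∈.∈-tabulate⁻ θ∈ | ⊓-sel (cdf E j) (1# - cdf E j)
    ... | inj₁ θ^≈ = record
      { orientation = true ; side = below j ; directed = above-directed j
      ; mean≈θ = trans (sym (cdf≈ j)) (trans (sym θ^≈) (reflexive (≡.sym θ≡)))
      ; 2θ≤1   = ≤-trans (≤-reflexive (*-congˡ (reflexive θ≡))) (2θ^≤1 j)
      }
    ... | inj₂ θ^≈ = record
      { orientation = false ; side = not ∘ below j ; directed = above-directed j
      ; mean≈θ = trans (sym (above≈ j)) (trans (sym θ^≈) (reflexive (≡.sym θ≡)))
      ; 2θ≤1   = ≤-trans (≤-reflexive (*-congˡ (reflexive θ≡))) (2θ^≤1 j)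
      }

-- Assembling the lower bound

≤-or : ∀ o p q {r s} → (o xor p) Bool.≤ (o xor q) → (o xor r) Bool.≤ (o xor s) →
       (o xor (p ∨ r)) Bool.≤ (o xor (q ∨ s))
≤-or false true  true  _  _   = Bool.b≤b
≤-or false false true  _  _   = Bool.≤-maximum _
≤-or false false false _  r≤s = r≤s
≤-or true  true  true  _  _   = Bool.b≤b
≤-or true  true  false _  _   = Bool.≤-minimum _
≤-or true  false false _  r≤s = r≤s

any-directed : ∀ o {d} (b c : Fin d → Bool) → (∀ r → (o xor b r) Bool.≤ (o xor c r)) →
               (o xor any b) Bool.≤ (o xor any c)
any-directed o {zero}  b c b≤c = Bool.b≤b
any-directed o {suc d} b c b≤c =
  ≤-or o (b zero) (c zero) (b≤c zero) (any-directed o (b ∘ suc) (c ∘ suc) (b≤c ∘ suc))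

update-increases : ∀ {n d} (x : Point n d) r {k} → lookup x r Fin.≤ k → Pointwise Fin._≤_ x (x [ r ]≔ k)
update-increases (l ∷ x) zero    l≤k  = l≤k Pointwise.∷ Pointwise.refl Fin.≤-refl
update-increases (l ∷ x) (suc r) xᵣ≤k = Fin.≤-refl Pointwise.∷ update-increases x r xᵣ≤k

update-decreases : ∀ {n d} (x : Point n d) r {k} → k Fin.≤ lookup x r → Pointwise Fin._≤_ (x [ r ]≔ k) x
update-decreases (l ∷ x) zero    k≤l  = k≤l Pointwise.∷ Pointwise.refl Fin.≤-refl
update-decreases (l ∷ x) (suc r) k≤xᵣ = Fin.≤-refl Pointwise.∷ update-decreases x r k≤xᵣ

module LowerBound {a ℓ₁ ℓ₂} (𝔽 : OrderedField a ℓ₁ ℓ₂) where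
  open Field 𝔽
  open Testing 𝔽
  open Expectation 𝔽
  open Distance 𝔽
  open QueryComplexity 𝔽
  open Blocks 𝔽

  module _ {n d q m} (D : ProductDistribution n d) {ε} (ε≤⅒ : ε ≤ fromℕ 10 ⁻¹) (A : Algorithm n d q)
    (tester : IsMonotonicityTester D ε A) (o : Bool) (σ : Fin m → Fin d → Fin n → Bool)
    (directed : ∀ i r → Directed o (σ i r))
    (disjoint : ∀ {i j} r k l → σ i r k ≡ true → j ≢ i → σ j r l ≡ false)
    (heavy : ∀ i → 1# ≤ fromℕ 4 * weight D (σ i)) (light : ∀ i → fromℕ 4 * weight D (σ i) ≤ fromℕ 3)
    where

    private
      y : Point n d → Fin m → Bool
      y x j = o xor special D (σ j) x

      y-monotone : ∀ {x z} → Pointwise Fin._≤_ x z → ∀ j → y x j Bool.≤ y z j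
      y-monotone x≤z j = any-directed o _ _ (λ r → directed j r (Pointwise.lookup x≤z r))

      special-new : ∀ i x r k → σ i r k ≡ true → special D (σ i) (x [ r ]≔ k) ≡ true
      special-new i x r k eq = any-true⁺ _ r (≡.trans (≡.cong (σ i r) (lookup∘update r x k)) eq)

      special-other : ∀ i x r k → σ i r k ≡ true → ∀ j → j ≢ i → special D (σ j) (x [ r ]≔ k) ≡ special D (σ j) x
      special-other i x r k eq j j≢i = any-cong same
        where
        same : ∀ s → σ j s (lookup (x [ r ]≔ k) s) ≡ σ j s (lookup x s)
        same s with s Fin.≟ r
        ... | yes ≡.refl = ≡.trans (disjoint s k _ eq j≢i) (≡.sym (disjoint s k _ eq j≢i))
        ... | no s≢r     = ≡.cong (σ j s) (lookup∘update′ s≢r x k)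

      module _ (i : Fin m) (ω : Fin (m ℕ.* 2 ℕ.^ m) → Fin (suc (12 ℕ.* q)))
               (g : Point n d → ℕ) (g-monotone : Monotone g) where

        h : Point n d → ℕ
        h = Hidden.hidden y ω true i

        -- Passing from x to x′ flips the i-th bit and, by `disjoint`, no other. It moves up for
        -- `o = false` and down for `o = true`. Inverting the digit makes `h` move strictly against
        -- this order, so the monotone `g` cannot equal `h` at both ends.
        disagree : ∀ x r k → special D (σ i) x ≡ false → σ i r k ≡ true →
                   h x ≡ g x → h (x [ r ]≔ k) ≢ g (x [ r ]≔ k)
        disagree x r k none eq hx≡ hx′≡ = byOrientation o ≡.refl
          where
          x′ = x [ r ]≔ k
          others : ∀ j → j ≢ i → y x′ j ≡ y x j
          others j j≢i = ≡.cong (o xor_) (special-other i x r k eq j j≢i)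
          xᵣ-false : σ i r (lookup x r) ≡ false
          xᵣ-false = any-false⁻ (λ r → σ i r (lookup x r)) r none
          y≡ : ∀ {b} → o ≡ b → y x i ≡ b
          y≡ ≡.refl rewrite none = Bool.xor-identityʳ o
          y′≡ : ∀ {b} → o ≡ b → y x′ i ≡ not b
          y′≡ ≡.refl rewrite special-new i x r k eq = Bool.xor-comm o true
          -- Directedness tells on which side of the old value of coordinate `r` the special value
          -- must lie, so that x and x′ are comparable in the right direction.
          wrong-order : ∀ {k l} → k Fin.≤ l → ¬ (o xor σ i r k ≡ true × o xor σ i r l ≡ false)
          wrong-order k≤l (p , p′) with directed i r k≤l
          ... | le rewrite p | p′ with () ← le
          byOrientation : ∀ b → o ≡ b → _
          byOrientation false o≡ = ℕ.<⇒≱ (Hidden.hidden-violation y ω i {x} {x′} (λ j j≢i → ≡.sym (others j j≢i)) (y≡ o≡) (y′≡ o≡))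
            (≡.subst₂ ℕ._≤_ (≡.sym hx≡) (≡.sym hx′≡) (g-monotone (update-increases x r
              (byOrder (Fin.≤-total (lookup x r) k)))))
            where
            byOrder : lookup x r Fin.≤ k ⊎ k Fin.≤ lookup x r → lookup x r Fin.≤ k
            byOrder (inj₁ le) = le
            byOrder (inj₂ ge) = contradiction
              (≡.cong₂ _xor_ o≡ eq , ≡.cong₂ _xor_ o≡ xᵣ-false) (wrong-order ge)
          byOrientation true o≡ = ℕ.<⇒≱ (Hidden.hidden-violation y ω i {x′} {x} others (y′≡ o≡) (y≡ o≡))
            (≡.subst₂ ℕ._≤_ (≡.sym hx′≡) (≡.sym hx≡) (g-monotone (update-decreases x r
              (byOrder (Fin.≤-total k (lookup x r))))))
            where
            byOrder : k Fin.≤ lookup x r ⊎ lookup x r Fin.≤ k → k Fin.≤ lookup x r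
            byOrder (inj₁ le) = le
            byOrder (inj₂ ge) = contradiction
              (≡.cong₂ _xor_ o≡ xᵣ-false , ≡.cong₂ _xor_ o≡ eq) (wrong-order ge)

        bad : Point n d → Bool
        bad x = does (¬? (h x ℕ.≟ g x))

        bad-pair : ∀ x z → (h x ≡ g x → h z ≢ g z) → 1# ≤ 𝟙 (bad x) + 𝟙 (bad z)
        bad-pair x z ≢ = byAgreement (h x ℕ.≟ g x)
          where
          byAgreement : Dec (h x ≡ g x) → 1# ≤ 𝟙 (bad x) + 𝟙 (bad z)
          byAgreement (yes eq) rewrite dec-false (h z ℕ.≟ g z) (≢ eq) = x≤y+x 1# (0≤𝟙 (bad x))
          byAgreement (no neq) rewrite dec-false (h x ℕ.≟ g x) neq = x≤x+y 1# (0≤𝟙 (bad z))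

        ε<dist : ε < dist D h g
        ε<dist = tenth< ε≤⅒ (16δ≥3 (heavy i) (light i) (begin
          P                                 ≤⟨ bad-mass D (σ i) bad P≤1 (λ x r k none eq → bad-pair x _ (disagree x r k none eq)) ⟩
          𝔼 D (λ x → 𝟙 (bad x)) + P * P     ≈⟨ +-congʳ (Pr≈𝔼 D (λ x → ¬? (h x ℕ.≟ g x))) ⟨
          dist D h g + P * P                ∎))
          where
          open ≤-Reasoning
          P = weight D (σ i)
          P≤1 : P ≤ 1#
          P≤1 = *-cancelˡ-≤ 3 (begin
            fromℕ 4 * P   ≤⟨ light i ⟩
            fromℕ 3       ≤⟨ x≤y+x (fromℕ 3) 0≤1 ⟩
            fromℕ 4       ≈⟨ *-identityʳ _ ⟨
            fromℕ 4 * 1#  ∎)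

    blocks≤queries : fromℕ 3 * fromℕ m ≤ fromℕ 12 * fromℕ q
    blocks≤queries = depth≤queries D A tester y y-monotone ε<dist

  gate-mean : ∀ {n} (E : Distribution n) b (s : Fin n → Bool) → mean E (λ k → 𝟙 (b ∧ s k)) ≈ 𝟙 b * mean E (𝟙 ∘ s)
  gate-mean E true  s = sym (*-identityˡ _)
  gate-mean E false s = trans (mean-const E 0#) (sym (zeroˡ _))

  gate-directed : ∀ {n} o b {s : Fin n → Bool} → Directed o s → Directed o (λ k → b ∧ s k)
  gate-directed o true  dir = dir
  gate-directed o false dir = λ _ → Bool.b≤b

  module _ {n d q} (D : ProductDistribution n d) {ε} (ε≤⅒ : ε ≤ fromℕ 10 ⁻¹) (A : Algorithm n d q)
    (tester : IsMonotonicityTester D ε A) where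
    open LightSide

    private
      L : ∀ r → LightSide (D r)
      L r = lightSide (D r)

      Θ : Carrier
      Θ = sum (λ r → θ (D r))

      oriented : Bool → Fin d → Bool
      oriented o r = does (orientation (L r) Bool.≟ o)

      w : Bool → Fin d → Carrier
      w o r = 𝟙 (oriented o r) * θ (D r)

      0≤θ : ∀ r → 0# ≤ θ (D r)
      0≤θ r = ≤-trans (≤-trans (≤-reflexive (sym (mean-const (D r) 0#))) (mean-mono (D r) (λ k → 0≤𝟙 (side (L r) k))))
                      (≤-reflexive (mean≈θ (L r)))

      selected-directed : ∀ o r → Directed o (λ k → oriented o r ∧ side (L r) k)
      selected-directed o r with orientation (L r) Bool.≟ o
      ... | yes ≡.refl = directed (L r)
      ... | no _       = λ _ → Bool.b≤b

      w-total : sum (w false) + sum (w true) ≈ Θ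
      w-total = trans (sym (∑-distrib-+ (w false) (w true))) (sum-cong-≋ both)
        where
        both : ∀ r → w false r + w true r ≈ θ (D r)
        both r with orientation (L r)
        ... | true  = trans (+-cong (zeroˡ _) (*-identityˡ _)) (+-identityˡ _)
        ... | false = trans (+-cong (*-identityˡ _) (zeroˡ _)) (+-identityʳ _)

      -- A disjunction mixing up-sets with down-sets need not be a monotone bit. Coordinates of the
      -- other orientation therefore get weight 0 in `w`; keeping the heavier class costs a factor
      -- 2.
      majority : ∃[ o ] Θ ≤ fromℕ 2 * sum (w o)
      majority with ≤-total (sum (w false)) (sum (w true))
      ... | inj₁ f≤t = true  , ≤-trans (≤-reflexive (sym w-total)) (≤-trans (+-monoˡ-≤ _ f≤t) (≤-reflexive (double _)))
      ... | inj₂ t≤f = false , ≤-trans (≤-reflexive (sym w-total)) (≤-trans (+-monoʳ-≤ _ t≤f) (≤-reflexive (double _)))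

    -- Blocks weigh at most 3/4 and the open one at most 1/4, so 2Θ ≤ 3m + 1 ≤ 12q + Θ: the
    -- assumption on Θ absorbs the open block.
    Θ≤12q : 1# ≤ Θ → Θ ≤ fromℕ 12 * fromℕ q
    Θ≤12q 1≤Θ with o , Θ≤2w ← majority = +-cancelʳ-≤ Θ (begin
      Θ + Θ                                        ≤⟨ +-mono-≤ Θ≤2w Θ≤2w ⟩
      fromℕ 2 * sum (w o) + fromℕ 2 * sum (w o)    ≈⟨ solve 1 (λ z → num 2 :* z :+ num 2 :* z := num 4 :* z) refl _ ⟩
      fromℕ 4 * sum (w o)                          ≤⟨ covering ⟩
      fromℕ 3 * fromℕ m + fromℕ 4 * blockWeight block (w o) m
        ≤⟨ +-mono-≤ (blocks≤queries D ε≤⅒ A tester o σ σ-directed σ-disjoint σ-heavy σ-light) (≤-trans partial 1≤Θ) ⟩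
      fromℕ 12 * fromℕ q + Θ                       ∎)
      where
      open ≤-Reasoning
      open Solver
      0≤w : ∀ r → 0# ≤ w o r
      0≤w r = *-nonNegative (0≤𝟙 (oriented o r)) (0≤θ r)
      2w≤1 : ∀ r → fromℕ 2 * w o r ≤ 1#
      2w≤1 r = ≤-trans (*-monoˡ-≤ (0≤fromℕ 2) (≤-trans (*-monoʳ-≤ (0≤θ r) (𝟙≤1 (oriented o r))) (≤-reflexive (*-identityˡ _))))
                       (2θ≤1 (L r))
      open Blocking (greedyBlocking (w o) 0≤w 2w≤1)
      σ : Fin m → Fin d → Fin n → Bool
      σ i r k = does (block r ℕ.≟ toℕ i) ∧ (oriented o r ∧ side (L r) k)
      σ-directed : ∀ i r → Directed o (σ i r)
      σ-directed i r = gate-directed o (does (block r ℕ.≟ toℕ i)) (selected-directed o r)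
      σ-disjoint : ∀ {i j} r k l → σ i r k ≡ true → j ≢ i → σ j r l ≡ false
      σ-disjoint {i} {j} r k l eq j≢i = ≡.cong (_∧ (oriented o r ∧ side (L r) l))
        (dec-false (block r ℕ.≟ toℕ j) λ p → j≢i (Fin.toℕ-injective (≡.trans (≡.sym p) inBlock)))
        where
        inBlock : block r ≡ toℕ i
        inBlock = ℕ.≡ᵇ⇒≡ (block r) (toℕ i) (proj₁ (Equivalence.to Bool.T-∧ (≡.subst T (≡.sym eq) _)))
      σ-weight : ∀ i → weight D (σ i) ≈ blockWeight block (w o) (toℕ i)
      σ-weight i = sum-cong-≋ λ r → trans (gate-mean (D r) (does (block r ℕ.≟ toℕ i)) _)
        (*-congˡ (trans (gate-mean (D r) (oriented o r) (side (L r))) (*-congˡ (mean≈θ (L r)))))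
      σ-heavy : ∀ i → 1# ≤ fromℕ 4 * weight D (σ i)
      σ-heavy i = ≤-trans (heavy (Fin.toℕ<n i)) (≤-reflexive (*-congˡ (sym (σ-weight i))))
      σ-light : ∀ i → fromℕ 4 * weight D (σ i) ≤ fromℕ 3
      σ-light i = ≤-trans (≤-reflexive (*-congˡ (σ-weight i))) (light (Fin.toℕ<n i))

theorem5p15 : ∀ {a ℓ₁ ℓ₂} (𝔽 : OrderedField a ℓ₁ ℓ₂) →
    let open OrderedField 𝔽
        open Testing 𝔽
    in ∃[ c ] ∃[ s ] 0# < c ×
       (∀ (n d : ℕ) (D : ProductDistribution n d) (ε : Carrier) →
        ε ≤ fromℕ 10 ⁻¹ →
        ∀ (q : ℕ) (A : Algorithm n d q) → IsMonotonicityTester D ε A →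
        s ≤ sum (λ r → θ (D r)) →
        c * sum (λ r → θ (D r)) ≤ fromℕ q)
-- Some threshold is unavoidable. If the sum of the θ's is positive but at most ε/2 with ε = 1/10, a
-- single point has mass at least 1 - ε; then no function is far, and accepting without queries is a
-- tester.
theorem5p15 𝔽 = fromℕ 12 ⁻¹ , 1# , (0≤suc⁻¹ 11 , 0≉12⁻¹) , λ n d D ε ε≤⅒ q A tester 1≤Θ →
  *-cancelˡ-≤ 11 (≤-trans (≤-reflexive (trans (sym (*-assoc _ _ _)) (trans (*-congʳ (suc-inverse 11)) (*-identityˡ _))))
                          (Θ≤12q D ε≤⅒ A tester 1≤Θ))
  where
  open Field 𝔽
  open LowerBound 𝔽
  0≉12⁻¹ : ¬ (0# ≈ fromℕ 12 ⁻¹)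
  0≉12⁻¹ 0≈ = 0≉1 (trans (sym (zeroʳ _)) (trans (*-congˡ 0≈) (suc-inverse 11)))
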